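{- The problem Binary DTW-Mean is solvable with $O(kn^3)$ arithmetic operations, where $k$ is the number of input time series and $n$ is the maximum length of any input time series. That is, there is an algorithm which, given time series $x^{(1)},\ldots,x^{(k)}\in\{0,1\}^*$ of maximum length $n$ and rational nonnegative weights $w_1,\ldots,w_k$, outputs, using $O(kn^3)$ arithmetic operations, a time series $z\in\{0,1\}^*$ that minimizes $F_w(z)=\sum_{i=1}^k w_i\,\mathrm{dtw}(z,x^{(i)})^2$ over all time series in $\{0,1\}^*$.
   Context: A time series of length $n\ge 1$ is a sequence $x=(x_1,\ldots,x_n)\in\mathbb{Q}^n$. Here $\{0,1\}^*$ denotes the set of all finite (nonempty) time series with elements in $\{0,1\}$, and $[n]=\{1,\ldots,n\}$. A warping path of order $m\times n$ is a sequence $p=(p_1,\ldots,p_L)$ with $p_\ell\in[m]\times[n]$ such that $p_1=(1,1)$, $p_L=(m,n)$, and $p_{\ell+1}-p_\ell\in\{(1,0),(0,1),(1,1)\}$ for all $\ell\in[L-1]$. The set of all of them is $\mathcal{P}_{m,n}$. For time series $x$ of length $m$ and $y$ of length $n$ and $p=((i_1,j_1),\ldots,(i_L,j_L))\in\mathcal{P}_{m,n}$, the cost is $C_p(x,y)=\sum_{\ell=1}^L(x_{i_\ell}-y_{j_\ell})^2$, and the dtw-distance is $\mathrm{dtw}(x,y)=\min_{p\in\mathcal{P}_{m,n}}\sqrt{C_p(x,y)}$. Binary DTW-Mean. Input: a sample of $k$ time series $x^{(1)},\ldots,x^{(k)}$ with elements in $\{0,1\}$ and rational nonnegative weights $w_1,\ldots,w_k$.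 Task: find $z\in\{0,1\}^*$ minimizing $F_w(z)=\sum_{i=1}^k w_i\,\mathrm{dtw}(z,x^{(i)})^2$. Running time is measured as the number of arithmetic operations (including comparisons) on rational numbers. -}

module Defs where

open import Data.Bool using (Bool; true; false; if_then_else_)
open import Data.Empty using (⊥-elim)
open import Data.Fin as Fin using (Fin; toℕ; fromℕ; fromℕ<)
import Data.Fin.Properties as Finₚ
open import Data.List as List using (List; []; _∷_)
open import Data.List.Membership.Propositional using (_∈_)
open import Data.List.Membership.Propositional.Properties using (∈-allFin; ∈-cartesianProduct⁺)
open import Data.List.NonEmpty as List⁺ using (List⁺; toList)
open import Data.List.Relation.Unary.Any using (here; there)
open import Data.List.Relation.Unary.Linked using (Linked; [-]; _∷_)
open import Data.Maybe using (just)
open import Data.Maybe.Properties using (just-injective)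
open import Data.Nat as ℕ using (ℕ; zero; suc; s≤s; _⊔_)
import Data.Nat.Properties as ℕₚ
open import Data.Product using (∃; _×_; _,_; proj₁; proj₂)
open import Data.Rational as ℚ using (ℚ; 0ℚ; 1ℚ; ≢-nonZero)
import Data.Rational.Properties as ℚₚ
open import Data.Sum using (_⊎_; inj₁; inj₂)
import Data.Vec.Functional as Vector
open import Relation.Binary.PropositionalEquality
open import Relation.Nullary using (¬_; Dec; yes; no; does)
open import Relation.Nullary.Decidable using (map′; _×-dec_; _⊎-dec_)

open import Algebra.Properties.CommutativeMonoid.Sum ℚₚ.+-0-commutativeMonoid using (sum-syntax)

------------------------------------------------------------------------
-- Time series and dynamic time warping

TimeSeries : Set
TimeSeries = List⁺ ℚ

-- Positions are numbered from 0, and a path indexed by m and n has order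
-- (1 + m) × (1 + n), because time series are nonempty.

Point : ℕ → ℕ → Set
Point m n = Fin (suc m) × Fin (suc n)

infix 4 _⟶_

data _⟶_ {m n} : Point m n → Point m n → Set where
  step₁₀ : ∀ {i j i′ j′} → toℕ i′ ≡ suc (toℕ i) → toℕ j′ ≡ toℕ j       → (i , j) ⟶ (i′ , j′)
  step₀₁ : ∀ {i j i′ j′} → toℕ i′ ≡ toℕ i       → toℕ j′ ≡ suc (toℕ j) → (i , j) ⟶ (i′ , j′)
  step₁₁ : ∀ {i j i′ j′} → toℕ i′ ≡ suc (toℕ i) → toℕ j′ ≡ suc (toℕ j) → (i , j) ⟶ (i′ , j′)

record WarpingPath (m n : ℕ) : Set where
  field
    points : List (Point m n)
    starts : List.head points ≡ just (Fin.zero , Fin.zero)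
    ends   : List.last points ≡ just (fromℕ m , fromℕ n)
    steps  : Linked _⟶_ points

open WarpingPath public

lastIndex : ∀ {A : Set} → List⁺ A → ℕ
lastIndex x = List.length (List⁺.tail x)

_!_ : ∀ {A : Set} (x : List⁺ A) → Fin (suc (lastIndex x)) → A
x ! i = List.lookup (toList x) i

module _ (x y : TimeSeries) where

  localCost : Point (lastIndex x) (lastIndex y) → ℚ
  localCost (i , j) = (x ! i ℚ.- y ! j) ℚ.* (x ! i ℚ.- y ! j)

  pointsCost : List (Point (lastIndex x) (lastIndex y)) → ℚ
  pointsCost ps = List.foldr ℚ._+_ 0ℚ (List.map localCost ps)

  cost : WarpingPath (lastIndex x) (lastIndex y) → ℚ
  cost p = pointsCost (points p)

IsMinimum : ∀ {A : Set} → (A → ℚ) → ℚ → Set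
IsMinimum f d = (∃ λ a → f a ≡ d) × (∀ a → d ℚ.≤ f a)

private
  _⟶?_ : ∀ {m n} (p q : Point m n) → Dec (p ⟶ q)
  (i , j) ⟶? (i′ , j′) = map′ to from
    ((toℕ i′ ℕ.≟ suc (toℕ i) ×-dec toℕ j′ ℕ.≟ toℕ j) ⊎-dec
     (toℕ i′ ℕ.≟ toℕ i ×-dec toℕ j′ ℕ.≟ suc (toℕ j)) ⊎-dec
     (toℕ i′ ℕ.≟ suc (toℕ i) ×-dec toℕ j′ ℕ.≟ suc (toℕ j)))
    where
    Cases : Set
    Cases = (toℕ i′ ≡ suc (toℕ i) × toℕ j′ ≡ toℕ j) ⊎
            (toℕ i′ ≡ toℕ i × toℕ j′ ≡ suc (toℕ j)) ⊎
            (toℕ i′ ≡ suc (toℕ i) × toℕ j′ ≡ suc (toℕ j))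

    to : Cases → (i , j) ⟶ (i′ , j′)
    to (inj₁ (a , b))        = step₁₀ a b
    to (inj₂ (inj₁ (a , b))) = step₀₁ a b
    to (inj₂ (inj₂ (a , b))) = step₁₁ a b

    from : (i , j) ⟶ (i′ , j′) → Cases
    from (step₁₀ a b) = inj₁ (a , b)
    from (step₀₁ a b) = inj₂ (inj₁ (a , b))
    from (step₁₁ a b) = inj₂ (inj₂ (a , b))

  rank : ∀ {m n} → Point m n → ℕ
  rank (i , j) = toℕ i ℕ.+ toℕ j

  rank-< : ∀ {m n} {p q : Point m n} → p ⟶ q → rank p ℕ.< rank q
  rank-< (step₁₀ a b) = ℕₚ.≤-reflexive (sym (cong₂ ℕ._+_ a b))
  rank-< {p = i , j} (step₀₁ a b) =
    ℕₚ.≤-reflexive (trans (sym (ℕₚ.+-suc (toℕ i) (toℕ j))) (sym (cong₂ ℕ._+_ a b)))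
  rank-< {p = i , j} (step₁₁ a b) =
    ℕₚ.≤-trans (s≤s (ℕₚ.+-monoʳ-≤ (toℕ i) (ℕₚ.n≤1+n (toℕ j))))
               (ℕₚ.≤-reflexive (sym (cong₂ ℕ._+_ a b)))

  rank-≤ : ∀ {m n} (p : Point m n) → rank p ℕ.≤ m ℕ.+ n
  rank-≤ (i , j) = ℕₚ.+-mono-≤ (Finₚ.toℕ≤pred[n] i) (Finₚ.toℕ≤pred[n] j)

  end : ∀ {m n} → Point m n
  end {m} {n} = fromℕ m , fromℕ n

  end-final : ∀ {m n} {q : Point m n} → ¬ (end ⟶ q)
  end-final {m} {n} {q} s = ℕₚ.<⇒≱ (rank-< s) (ℕₚ.≤-trans (rank-≤ q)
    (ℕₚ.≤-reflexive (sym (cong₂ ℕ._+_ (Finₚ.toℕ-fromℕ m) (Finₚ.toℕ-fromℕ n)))))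

  next : ∀ {m} (i : Fin (suc m)) → (i ≡ fromℕ m) ⊎ ∃ λ (i′ : Fin (suc m)) → toℕ i′ ≡ suc (toℕ i)
  next {m} i with toℕ i ℕ.<? m
  ... | yes i<m = inj₂ (fromℕ< (s≤s i<m) , Finₚ.toℕ-fromℕ< (s≤s i<m))
  ... | no  i≮m = inj₁ (Finₚ.toℕ-injective
    (trans (ℕₚ.≤-antisym (Finₚ.toℕ≤pred[n] i) (ℕₚ.≮⇒≥ i≮m)) (sym (Finₚ.toℕ-fromℕ m))))

  progress : ∀ {m n} (p : Point m n) → (p ≡ end) ⊎ ∃ λ q → p ⟶ q
  progress (i , j) with next i | next j
  ... | inj₂ (i′ , e) | _             = inj₂ ((i′ , j) , step₁₀ e refl)
  ... | inj₁ _        | inj₂ (j′ , e) = inj₂ ((i , j′) , step₀₁ refl e)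
  ... | inj₁ refl     | inj₁ refl     = inj₁ refl

  allPoints : ∀ m n → List (Point m n)
  allPoints m n = List.cartesianProduct (List.allFin (suc m)) (List.allFin (suc n))

  module Existence (x y : TimeSeries) where

    P : Set
    P = Point (lastIndex x) (lastIndex y)

    c : List P → ℚ
    c = pointsCost x y

    Chain : P → List P → Set
    Chain p ps = Linked _⟶_ (p ∷ ps) × List.last (p ∷ ps) ≡ just end

    Best : P → Set
    Best p = ∃ λ ps → Chain p ps × (∀ qs → Chain p qs → c (p ∷ ps) ℚ.≤ c (p ∷ qs))

    Best∈ : P → List P → Set
    Best∈ p L = ∃ λ ps → Chain p ps ×
      (∀ q qs → q ∈ L → Chain p (q ∷ qs) → c (p ∷ ps) ℚ.≤ c (p ∷ q ∷ qs))

    prepend : ∀ p {ps qs} → c ps ℚ.≤ c qs → c (p ∷ ps) ℚ.≤ c (p ∷ qs)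
    prepend p = ℚₚ.+-monoʳ-≤ (localCost x y p)

    bestStep : ∀ p → (∀ q → p ⟶ q → Best q) → (L : List P) →
               (∀ q → q ∈ L → ¬ (p ⟶ q)) ⊎ Best∈ p L
    bestStep p best [] = inj₁ λ _ ()
    bestStep p best (q ∷ L) with p ⟶? q | bestStep p best L
    ... | no  ¬s | inj₁ none = inj₁ λ { _ (here refl) → ¬s ; r (there r∈) → none r r∈ }
    ... | no  ¬s | inj₂ (ps , ch , min) = inj₂ (ps , ch , λ
          { _ _ (here refl) (s ∷ _ , _) → ⊥-elim (¬s s)
          ; r rs (there r∈) ch′ → min r rs r∈ ch′ })
    ... | yes s | inj₁ none with best q s
    ...   | ps , (lk , e) , min = inj₂ (q ∷ ps , (s ∷ lk , e) , λ
          { _ rs (here refl) (_ ∷ lk′ , e′) → prepend p {q ∷ ps} {q ∷ rs} (min rs (lk′ , e′))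
          ; r rs (there r∈) (s′ ∷ _ , _) → ⊥-elim (none r r∈ s′) })
    bestStep p best (q ∷ L) | yes s | inj₂ (ps′ , ch′ , min′) with best q s
    ...   | ps , (lk , e) , min with ℚₚ.≤-total (c (p ∷ q ∷ ps)) (c (p ∷ ps′))
    ...     | inj₁ le = inj₂ (q ∷ ps , (s ∷ lk , e) , λ
          { _ rs (here refl) (_ ∷ lk″ , e″) → prepend p {q ∷ ps} {q ∷ rs} (min rs (lk″ , e″))
          ; r rs (there r∈) ch″ → ℚₚ.≤-trans le (min′ r rs r∈ ch″) })
    ...     | inj₂ ge = inj₂ (ps′ , ch′ , λ
          { _ rs (here refl) (_ ∷ lk″ , e″) →
              ℚₚ.≤-trans ge (prepend p {q ∷ ps} {q ∷ rs} (min rs (lk″ , e″)))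
          ; r rs (there r∈) ch″ → min′ r rs r∈ ch″ })

    ∈-allPoints : (q : P) → q ∈ allPoints (lastIndex x) (lastIndex y)
    ∈-allPoints (i , j) = ∈-cartesianProduct⁺ (∈-allFin i) (∈-allFin j)

    notEnd : ∀ {p q : P} → p ⟶ q → ¬ (just p ≡ just end)
    notEnd s e with just-injective e
    ... | refl = end-final s

    best : ∀ fuel p → lastIndex x ℕ.+ lastIndex y ℕ.< rank p ℕ.+ fuel → Best p
    best zero p h = ⊥-elim (ℕₚ.<⇒≱ h
      (ℕₚ.≤-trans (ℕₚ.≤-reflexive (ℕₚ.+-identityʳ (rank p))) (rank-≤ p)))
    best (suc f) p h with progress p
    ... | inj₁ refl = [] , ([-] , refl) , λ
          { [] _ → ℚₚ.≤-refl ; (_ ∷ _) (s ∷ _ , _) → ⊥-elim (end-final s) }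
    ... | inj₂ (q , s) with bestStep p
            (λ r t → best f r (ℕₚ.≤-trans h (ℕₚ.≤-trans (ℕₚ.≤-reflexive (ℕₚ.+-suc (rank p) f))
                                                     (ℕₚ.+-monoˡ-≤ f (rank-< t)))))
            (allPoints (lastIndex x) (lastIndex y))
    ...   | inj₁ none = ⊥-elim (none q (∈-allPoints q) s)
    ...   | inj₂ (ps , ch , min) = ps , ch , λ
          { [] (_ , e) → ⊥-elim (notEnd s e)
          ; (r ∷ rs) ch′ → min r rs (∈-allPoints r) ch′ }

    minimum : ∃ (IsMinimum (cost x y))
    minimum with best (suc (lastIndex x ℕ.+ lastIndex y)) (Fin.zero , Fin.zero) ℕₚ.≤-refl
    ... | ps , (lk , e) , min =
      _ , (record { points = _ ∷ ps ; starts = refl ; ends = e ; steps = lk } , refl) , bound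
      where
      bound : ∀ p → c ((Fin.zero , Fin.zero) ∷ ps) ℚ.≤ cost x y p
      bound record { points = _ ∷ qs ; starts = refl ; ends = e′ ; steps = lk′ } = min qs (lk′ , e′)

abstract
  minimalCost : ∀ x y → ∃ (IsMinimum (cost x y))
  minimalCost = Existence.minimum

-- The square of the dtw-distance: √ is monotone, so (min √C)² = min C, and
-- the minimum of the costs stays within ℚ.

dtw² : TimeSeries → TimeSeries → ℚ
dtw² x y = proj₁ (minimalCost x y)

dtw²-isMinimum : ∀ x y → IsMinimum (cost x y) (dtw² x y)
dtw²-isMinimum x y = proj₂ (minimalCost x y)

------------------------------------------------------------------------
-- Binary DTW-Mean

BinarySeries : Set
BinarySeries = List⁺ Bool

bit : Bool → ℚ
bit b = if b then 1ℚ else 0ℚ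

⟦_⟧ : BinarySeries → TimeSeries
⟦_⟧ = List⁺.map bit

record Sample (k : ℕ) : Set where
  field
    series     : Fin k → BinarySeries
    weight     : Fin k → ℚ
    weight-≥0  : ∀ i → 0ℚ ℚ.≤ weight i

  maxLength : ℕ
  maxLength = Vector.foldr _⊔_ 0 (λ i → List⁺.length (series i))

  F : BinarySeries → ℚ
  F z = ∑[ i < k ] (weight i ℚ.* dtw² ⟦ z ⟧ ⟦ series i ⟧)

  IsBinaryMean : BinarySeries → Set
  IsBinaryMean z = ∀ z′ → F z ℚ.≤ F z′

open Sample public

------------------------------------------------------------------------
-- Model of computation: structured programs over an unbounded memory.
--
-- Arrays have two subscripts and a name fixed in the program text; each name
-- denotes one array of rationals and one of natural numbers, and only the
-- latter serve as subscripts.  Rationals cannot be converted to naturals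
-- except by computing with both.
--
-- Every arithmetic operation and every comparison costs 1, on rationals and
-- on naturals alike: free index arithmetic could do unbounded work unnoticed.
-- Reading, assigning and constants are free.  Each loop iteration evaluates a
-- test, so for a fixed program the count also bounds, up to a constant factor
-- and an additive constant, all instructions executed.

Name : Set
Name = ℕ

Memory : Set → Set
Memory A = Name → ℕ → ℕ → A

record State : Set where
  constructor ⟨_,_⟩
  field
    nat : Memory ℕ
    rat : Memory ℚ

open State public

_[_,_,_]≔_ : ∀ {A : Set} → Memory A → Name → ℕ → ℕ → A → Memory A
(μ [ a , i , j ]≔ v) b i′ j′ =
  if does (b ℕ.≟ a ×-dec i′ ℕ.≟ i ×-dec j′ ℕ.≟ j) then v else μ b i′ j′

data ℕOp : Set where
  add monus : ℕOp

data ℚOp : Set where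
  add sub mul div : ℚOp

data ℕExpr : Set where
  lit  : ℕ → ℕExpr
  read : Name → ℕExpr → ℕExpr → ℕExpr
  op   : ℕOp → ℕExpr → ℕExpr → ℕExpr

data ℚExpr : Set where
  lit  : ℚ → ℚExpr
  read : Name → ℕExpr → ℕExpr → ℚExpr
  op   : ℚOp → ℚExpr → ℚExpr → ℚExpr

data Test : Set where
  _≤ℕ_ : ℕExpr → ℕExpr → Test
  _≤ℚ_ : ℚExpr → ℚExpr → Test

infixr 5 _⨾_

data Program : Set where
  skip    : Program
  assignℕ : Name → ℕExpr → ℕExpr → ℕExpr → Program
  assignℚ : Name → ℕExpr → ℕExpr → ℚExpr → Program
  _⨾_     : Program → Program → Program
  branch  : Test → Program → Program → Program
  while   : Test → Program → Program

evalℕOp : ℕOp → ℕ → ℕ → ℕ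
evalℕOp add   = ℕ._+_
evalℕOp monus = ℕ._∸_

-- Division by 0 yields 0.

evalℚOp : ℚOp → ℚ → ℚ → ℚ
evalℚOp add p q = p ℚ.+ q
evalℚOp sub p q = p ℚ.- q
evalℚOp mul p q = p ℚ.* q
evalℚOp div p q with q ℚ.≟ 0ℚ
... | yes _   = 0ℚ
... | no  q≢0 = ℚ._÷_ p q {{≢-nonZero q≢0}}

evalℕ : ℕExpr → State → ℕ
evalℕ (lit n)      σ = n
evalℕ (read a d e) σ = nat σ a (evalℕ d σ) (evalℕ e σ)
evalℕ (op o d e)   σ = evalℕOp o (evalℕ d σ) (evalℕ e σ)

evalℚ : ℚExpr → State → ℚ
evalℚ (lit q)      σ = q
evalℚ (read a d e) σ = rat σ a (evalℕ d σ) (evalℕ e σ)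
evalℚ (op o d e)   σ = evalℚOp o (evalℚ d σ) (evalℚ e σ)

evalTest : Test → State → Bool
evalTest (d ≤ℕ e) σ = does (evalℕ d σ ℕ.≤? evalℕ e σ)
evalTest (d ≤ℚ e) σ = does (evalℚ d σ ℚ.≤? evalℚ e σ)

opsℕ : ℕExpr → ℕ
opsℕ (lit _)      = 0
opsℕ (read _ d e) = opsℕ d ℕ.+ opsℕ e
opsℕ (op _ d e)   = suc (opsℕ d ℕ.+ opsℕ e)

opsℚ : ℚExpr → ℕ
opsℚ (lit _)      = 0
opsℚ (read _ d e) = opsℕ d ℕ.+ opsℕ e
opsℚ (op _ d e)   = suc (opsℚ d ℕ.+ opsℚ e)

opsTest : Test → ℕ
opsTest (d ≤ℕ e) = suc (opsℕ d ℕ.+ opsℕ e)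
opsTest (d ≤ℚ e) = suc (opsℚ d ℕ.+ opsℚ e)

-- π , σ ⇓ σ′ # t : run from σ, the program π halts in σ′ after t operations.

infix 4 _,_⇓_#_

data _,_⇓_#_ : Program → State → State → ℕ → Set where

  ⇓skip : ∀ {σ} → skip , σ ⇓ σ # 0

  ⇓assignℕ : ∀ {a d e v σ} →
    assignℕ a d e v , σ
      ⇓ ⟨ nat σ [ a , evalℕ d σ , evalℕ e σ ]≔ evalℕ v σ , rat σ ⟩
      # (opsℕ d ℕ.+ opsℕ e ℕ.+ opsℕ v)

  ⇓assignℚ : ∀ {a d e v σ} →
    assignℚ a d e v , σ
      ⇓ ⟨ nat σ , rat σ [ a , evalℕ d σ , evalℕ e σ ]≔ evalℚ v σ ⟩
      # (opsℕ d ℕ.+ opsℕ e ℕ.+ opsℚ v)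

  ⇓⨾ : ∀ {π ρ σ σ′ σ″ s t} →
    π , σ ⇓ σ′ # s → ρ , σ′ ⇓ σ″ # t → (π ⨾ ρ) , σ ⇓ σ″ # (s ℕ.+ t)

  ⇓branch-true : ∀ {b π ρ σ σ′ t} → evalTest b σ ≡ true →
    π , σ ⇓ σ′ # t → branch b π ρ , σ ⇓ σ′ # (opsTest b ℕ.+ t)

  ⇓branch-false : ∀ {b π ρ σ σ′ t} → evalTest b σ ≡ false →
    ρ , σ ⇓ σ′ # t → branch b π ρ , σ ⇓ σ′ # (opsTest b ℕ.+ t)

  ⇓while-true : ∀ {b π σ σ′ σ″ s t} → evalTest b σ ≡ true →
    π , σ ⇓ σ′ # s → while b π , σ′ ⇓ σ″ # t →
    while b π , σ ⇓ σ″ # (opsTest b ℕ.+ s ℕ.+ t)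

  ⇓while-false : ∀ {b π σ} → evalTest b σ ≡ false →
    while b π , σ ⇓ σ # opsTest b

------------------------------------------------------------------------
-- Input and output conventions

record Stores (σ : State) (a : Name) (row : ℕ) (z : BinarySeries) : Set where
  field
    length  : nat σ a row 0 ≡ List⁺.length z
    entries : ∀ j → rat σ a row (toℕ j) ≡ ⟦ z ⟧ ! j

-- Cells not mentioned here may initially contain anything.

record Input {k : ℕ} (S : Sample k) (σ : State) : Set where
  field
    size    : nat σ 0 0 0 ≡ k
    weights : ∀ i → rat σ 0 0 (toℕ i) ≡ weight S i
    samples : ∀ i → Stores σ 1 (toℕ i) (series S i)

Output : BinarySeries → State → Set
Output z σ = Stores σ 2 0 z

{-# OPTIONS --safe #-}

-- Collapsing equal neighbours of z never increases dtw(z, x), so some mean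
-- alternates between 0 and 1.  If n is the maximal length, an alternating
-- series with more than 3n entries is no better than the series (0): warping
-- it onto a sample costs at least n, since two neighbouring entries cannot
-- both match the same sample entry for free, whereas (0) costs at most n.
-- This leaves O(n) candidates; each is evaluated in O(kn²) by the usual
-- dynamic program.

module Submission where

open import Defs
open import Data.Bool as Bool using (Bool; true; false; not; if_then_else_; _∨_)
open import Data.Empty using (⊥)
open import Data.Fin as Fin using (Fin; toℕ; fromℕ; fromℕ<)
import Data.Fin.Properties as Finₚ
open import Data.List as List using (List; []; _∷_)
import Data.List.Properties as Listₚ
open import Data.List.NonEmpty as List⁺ using (List⁺; _∷_)
open import Data.List.Relation.Unary.Linked using (Linked; [-]; _∷_)
open import Data.Maybe using (just)
open import Data.Nat using (ℕ; NonZero; _*_; _^_; _≤_)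
open import Data.Nat using (zero; suc; s≤s; z≤n; _+_; _∸_; _<_; _⊔_; _≤?_; _<?_; _≟_; >-nonZero⁻¹)
open import Data.Nat.Properties hiding (_≤?_; _<?_; _≟_)
import Data.Nat.Solver as ℕSolver
open import Data.Product using (Σ-syntax; ∃-syntax; _×_)
open import Data.Product using (∃; _,_; proj₁; proj₂)
open import Data.Rational as ℚ using (ℚ; 0ℚ; 1ℚ; ½; _⊓_)
import Data.Rational.Properties as ℚₚ
import Data.Rational.Solver as ℚSolver
open import Data.Sum using (_⊎_; inj₁; inj₂; [_,_])
import Data.Vec.Functional as Vector
open import Function using (_∘_)
open import Relation.Binary.PropositionalEquality hiding ([_])
open import Relation.Nullary using (¬_; yes; no; does)
open import Relation.Nullary.Decidable using (_×-dec_; dec-true; dec-false)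
open import Algebra.Properties.CommutativeMonoid.Sum ℚₚ.+-0-commutativeMonoid using (sum; sum-init-last; sum-cong-≗)

-- Warping paths occur only in the proof that `dtw²` equals the table entry `dp`. From there on,
-- distances are compared through their tables. Since `dp` is the greatest function obeying the
-- three step inequalities, a lower bound on a distance amounts to a potential that is checked one
-- step at a time, and no path is ever cut or spliced. Condensing takes the table of the condensed
-- series as potential; the bound for long series takes half the difference of the two indices plus
-- half the local cost. The second potential is also the origin of the factor 3: it makes twice the
-- cost at least the row index minus the column index, so reaching cost n in column n - 1 takes 2n
-- rows more than that. Running times are stated in terms of N = 3n, which bounds at once the number
-- of candidates with a given first entry, their lengths and the lengths of the samples.

square-≥0 : ∀ p → 0ℚ ℚ.≤ p ℚ.* p
square-≥0 p with ℚₚ.≤-total 0ℚ p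
... | inj₁ 0≤p = ℚₚ.nonNegative⁻¹ (p ℚ.* p)
                   {{ℚₚ.nonNeg*nonNeg⇒nonNeg p {{ℚ.nonNegative 0≤p}} p {{ℚ.nonNegative 0≤p}}}}
... | inj₂ p≤0 = ℚₚ.nonNegative⁻¹ (p ℚ.* p)
                   {{ℚₚ.nonPos*nonPos⇒nonPos p {{ℚ.nonPositive p≤0}} p {{ℚ.nonPositive p≤0}}}}

p≤p+q : ∀ {p q} → 0ℚ ℚ.≤ q → p ℚ.≤ p ℚ.+ q
p≤p+q {p} {q} 0≤q = subst (ℚ._≤ p ℚ.+ q) (ℚₚ.+-identityʳ p) (ℚₚ.+-monoʳ-≤ p 0≤q)

-- With `≤⇒0≤`, this reduces an inequality to a ring identity for the difference, which the solver
-- can check, and a sum of visibly nonnegative terms.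
0≤⇒≤ : ∀ {p q} → 0ℚ ℚ.≤ q ℚ.- p → p ℚ.≤ q
0≤⇒≤ {p} {q} h = subst (p ℚ.≤_) (solve 2 (λ p q → p :+ (q :- p) := q) refl p q) (p≤p+q h)
  where open ℚSolver.+-*-Solver

≤⇒0≤ : ∀ {p q} → p ℚ.≤ q → 0ℚ ℚ.≤ q ℚ.- p
≤⇒0≤ {p} {q} h = subst (ℚ._≤ q ℚ.- p) (ℚₚ.+-inverseʳ p) (ℚₚ.+-monoˡ-≤ (ℚ.- p) h)

-- Dynamic programming

module Table (f g : ℕ → ℚ) where

  gap : ℕ → ℕ → ℚ
  gap i j = (f i ℚ.- g j) ℚ.* (f i ℚ.- g j)

  -- `before` separates the best predecessor from the local cost because the program computes them
  -- separately; the minima are nested in the order in which `predecessor` takes them. The indices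
  -- are unbounded, so one table serves every length.
  before dp : ℕ → ℕ → ℚ
  dp i j = before i j ℚ.+ gap i j
  before zero    zero    = 0ℚ
  before zero    (suc j) = dp zero j
  before (suc i) zero    = dp i zero
  before (suc i) (suc j) = (dp i j ⊓ dp i (suc j)) ⊓ dp (suc i) j

  gap-≥0 : ∀ i j → 0ℚ ℚ.≤ gap i j
  gap-≥0 i j = square-≥0 (f i ℚ.- g j)

  dp-step₁₀ : ∀ i j → dp (suc i) j ℚ.≤ dp i j ℚ.+ gap (suc i) j
  dp-step₁₀ i zero    = ℚₚ.≤-refl
  dp-step₁₀ i (suc j) = ℚₚ.+-monoˡ-≤ (gap (suc i) (suc j))
    (ℚₚ.≤-trans (ℚₚ.p⊓q≤p _ (dp (suc i) j)) (ℚₚ.p⊓q≤q (dp i j) _))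

  dp-step₀₁ : ∀ i j → dp i (suc j) ℚ.≤ dp i j ℚ.+ gap i (suc j)
  dp-step₀₁ zero    j = ℚₚ.≤-refl
  dp-step₀₁ (suc i) j = ℚₚ.+-monoˡ-≤ (gap (suc i) (suc j)) (ℚₚ.p⊓q≤q (dp i j ⊓ dp i (suc j)) _)

  dp-step₁₁ : ∀ i j → dp (suc i) (suc j) ℚ.≤ dp i j ℚ.+ gap (suc i) (suc j)
  dp-step₁₁ i j = ℚₚ.+-monoˡ-≤ (gap (suc i) (suc j))
    (ℚₚ.≤-trans (ℚₚ.p⊓q≤p _ (dp (suc i) j)) (ℚₚ.p⊓q≤p (dp i j) _))

  -- The minimum in `before` is attained at one of the neighbours, and the inequality for the step
  -- from that neighbour suffices. Every lower bound on a table comes from this principle.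
  dp-greatest : (r : ℕ → ℕ → ℚ) →
    r 0 0 ℚ.≤ gap 0 0 →
    (∀ i j → r (suc i) j ℚ.≤ r i j ℚ.+ gap (suc i) j) →
    (∀ i j → r i (suc j) ℚ.≤ r i j ℚ.+ gap i (suc j)) →
    (∀ i j → r (suc i) (suc j) ℚ.≤ r i j ℚ.+ gap (suc i) (suc j)) →
    ∀ i j → r i j ℚ.≤ dp i j
  dp-greatest r r₀₀ s₁₀ s₀₁ s₁₁ = go
    where
    go : ∀ i j → r i j ℚ.≤ dp i j
    go zero    zero    = ℚₚ.≤-trans r₀₀ (ℚₚ.≤-reflexive (sym (ℚₚ.+-identityˡ (gap 0 0))))
    go zero    (suc j) = ℚₚ.≤-trans (s₀₁ zero j) (ℚₚ.+-monoˡ-≤ _ (go zero j))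
    go (suc i) zero    = ℚₚ.≤-trans (s₁₀ i zero) (ℚₚ.+-monoˡ-≤ _ (go i zero))
    go (suc i) (suc j) with ℚₚ.⊓-sel (dp i j ⊓ dp i (suc j)) (dp (suc i) j)
    ... | inj₂ e = ℚₚ.≤-trans (s₀₁ (suc i) j)
                     (ℚₚ.+-monoˡ-≤ _ (ℚₚ.≤-trans (go (suc i) j) (ℚₚ.≤-reflexive (sym e))))
    ... | inj₁ e with ℚₚ.⊓-sel (dp i j) (dp i (suc j))
    ...   | inj₁ e′ = ℚₚ.≤-trans (s₁₁ i j)
                     (ℚₚ.+-monoˡ-≤ _ (ℚₚ.≤-trans (go i j) (ℚₚ.≤-reflexive (sym (trans e e′)))))
    ...   | inj₂ e′ = ℚₚ.≤-trans (s₁₀ i (suc j))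
                     (ℚₚ.+-monoˡ-≤ _ (ℚₚ.≤-trans (go i (suc j)) (ℚₚ.≤-reflexive (sym (trans e e′)))))

  module _ (x y : TimeSeries)
           (f≗x : ∀ i → f (toℕ i) ≡ x ! i) (g≗y : ∀ j → g (toℕ j) ≡ y ! j) where

    private
      m n : ℕ
      m = lastIndex x
      n = lastIndex y

      end : Point m n
      end = fromℕ m , fromℕ n

      dpₚ : Point m n → ℚ
      dpₚ (i , j) = dp (toℕ i) (toℕ j)

    localCost≡gap : ∀ i j → localCost x y (i , j) ≡ gap (toℕ i) (toℕ j)
    localCost≡gap i j = cong₂ (λ a b → (a ℚ.- b) ℚ.* (a ℚ.- b)) (sym (f≗x i)) (sym (g≗y j))

    dp-⟶ : ∀ {p q : Point m n} → p ⟶ q → dpₚ q ℚ.≤ dpₚ p ℚ.+ localCost x y q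
    dp-⟶ {i , j} {i′ , j′} s rewrite localCost≡gap i′ j′ with s
    ... | step₁₀ a b rewrite a | b = dp-step₁₀ (toℕ i) (toℕ j)
    ... | step₀₁ a b rewrite a | b = dp-step₀₁ (toℕ i) (toℕ j)
    ... | step₁₁ a b rewrite a | b = dp-step₁₁ (toℕ i) (toℕ j)

    -- Generalised from the start of a path to any point on it, to allow induction on the rest:
    -- `dpₚ p` pays for everything up to and including `p`, and `ps` for what follows.
    dp≤pointsCost : ∀ p ps → Linked _⟶_ (p ∷ ps) → List.last (p ∷ ps) ≡ just end →
                    dp m n ℚ.≤ dpₚ p ℚ.+ pointsCost x y ps
    dp≤pointsCost p [] _ refl = ℚₚ.≤-reflexive
      (trans (sym (cong₂ dp (Finₚ.toℕ-fromℕ m) (Finₚ.toℕ-fromℕ n))) (sym (ℚₚ.+-identityʳ _)))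
    dp≤pointsCost p (q ∷ ps) (s ∷ lk) e = begin
      dp m n                                             ≤⟨ dp≤pointsCost q ps lk e ⟩
      dpₚ q ℚ.+ pointsCost x y ps                        ≤⟨ ℚₚ.+-monoˡ-≤ (pointsCost x y ps) (dp-⟶ s) ⟩
      (dpₚ p ℚ.+ localCost x y q) ℚ.+ pointsCost x y ps  ≡⟨ ℚₚ.+-assoc (dpₚ p) _ _ ⟩
      dpₚ p ℚ.+ pointsCost x y (q ∷ ps)                  ∎
      where open ℚₚ.≤-Reasoning

    dp≤cost : ∀ p → dp m n ℚ.≤ cost x y p
    dp≤cost record { points = _ ∷ ps ; starts = refl ; ends = e ; steps = lk } =
      ℚₚ.≤-trans (dp≤pointsCost _ ps lk e) (ℚₚ.≤-reflexive (cong (ℚ._+ pointsCost x y ps)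
        (trans (ℚₚ.+-identityˡ _) (sym (localCost≡gap Fin.zero Fin.zero)))))

    private
      at : ∀ {i j} → i < suc m → j < suc n → Point m n
      at i< j< = fromℕ< i< , fromℕ< j<

      localCost-at : ∀ {i j} (i< : i < suc m) (j< : j < suc n) →
                     localCost x y (at i< j<) ≡ gap i j
      localCost-at i< j< = trans (localCost≡gap (fromℕ< i<) (fromℕ< j<))
                                 (cong₂ gap (Finₚ.toℕ-fromℕ< i<) (Finₚ.toℕ-fromℕ< j<))

      -- Think of `ps` as the end of a path whose earlier points cost `d`. Only the total cost is
      -- recorded, since nothing else is asked of the path.
      Completes : ℚ → List (Point m n) → Set
      Completes d ps = ∃ λ p → cost x y p ≡ d ℚ.+ pointsCost x y ps

      below : ∀ {i k} → suc i < k → i < k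
      below = <-trans (n<1+n _)

      toℕ-suc : ∀ {i k} (i< : suc i < k) → toℕ (fromℕ< i<) ≡ suc (toℕ (fromℕ< (below i<)))
      toℕ-suc i< = trans (Finₚ.toℕ-fromℕ< i<) (cong suc (sym (Finₚ.toℕ-fromℕ< (below i<))))

      extend : ∀ {i j} (i< : i < suc m) (j< : j < suc n) {d} ps → before i j ≡ d →
               Completes d (at i< j< ∷ ps) → Completes (dp i j) ps
      extend {i} {j} i< j< {d} ps e (p , c) = p , (begin
        cost x y p
          ≡⟨ c ⟩
        d ℚ.+ (localCost x y (at i< j<) ℚ.+ pointsCost x y ps)
          ≡⟨ ℚₚ.+-assoc d _ _ ⟨
        (d ℚ.+ localCost x y (at i< j<)) ℚ.+ pointsCost x y ps
          ≡⟨ cong₂ (λ a b → (a ℚ.+ b) ℚ.+ pointsCost x y ps) (sym e) (localCost-at i< j<) ⟩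
        dp i j ℚ.+ pointsCost x y ps
          ∎)
        where open ≡-Reasoning

    -- Traces an optimal path backwards from the end. The part found so far is the accumulator, so
    -- that each predecessor attaining the minimum is put in front and lists never need to be
    -- appended.
    complete : ∀ i j (i< : i < suc m) (j< : j < suc n) {ps} →
               Linked _⟶_ (at i< j< ∷ ps) → List.last (at i< j< ∷ ps) ≡ just end →
               Completes (dp i j) ps
    complete zero zero (s≤s _) (s≤s _) {ps} lk e =
      record { points = _ ∷ ps ; starts = refl ; ends = e ; steps = lk } ,
      cong (ℚ._+ pointsCost x y ps)
        (trans (localCost≡gap Fin.zero Fin.zero) (sym (ℚₚ.+-identityˡ _)))
    complete zero (suc j) i< j< {ps} lk e =
      extend i< j< ps refl (complete zero j i< (below j<) (step₀₁ refl (toℕ-suc j<) ∷ lk) e)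
    complete (suc i) zero i< j< {ps} lk e =
      extend i< j< ps refl (complete i zero (below i<) j< (step₁₀ (toℕ-suc i<) refl ∷ lk) e)
    complete (suc i) (suc j) i< j< {ps} lk e with ℚₚ.⊓-sel (dp i j ⊓ dp i (suc j)) (dp (suc i) j)
    ... | inj₂ s = extend i< j< ps s
            (complete (suc i) j i< (below j<) (step₀₁ refl (toℕ-suc j<) ∷ lk) e)
    ... | inj₁ s with ℚₚ.⊓-sel (dp i j) (dp i (suc j))
    ...   | inj₁ s′ = extend i< j< ps (trans s s′)
            (complete i j (below i<) (below j<) (step₁₁ (toℕ-suc i<) (toℕ-suc j<) ∷ lk) e)
    ...   | inj₂ s′ = extend i< j< ps (trans s s′)
            (complete i (suc j) (below i<) j< (step₁₀ (toℕ-suc i<) refl ∷ lk) e)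

    dtw²≡dp : dtw² x y ≡ dp m n
    dtw²≡dp = ℚₚ.≤-antisym upper lower
      where
      m< : m < suc m
      m< = n<1+n m
      n< : n < suc n
      n< = n<1+n n

      optimal : Completes (dp m n) []
      optimal = complete m n m< n< [-] (cong₂ (λ i j → just (i , j))
        (Finₚ.toℕ-injective (trans (Finₚ.toℕ-fromℕ< m<) (sym (Finₚ.toℕ-fromℕ m))))
        (Finₚ.toℕ-injective (trans (Finₚ.toℕ-fromℕ< n<) (sym (Finₚ.toℕ-fromℕ n)))))

      upper : dtw² x y ℚ.≤ dp m n
      upper = ℚₚ.≤-trans (proj₂ (dtw²-isMinimum x y) (proj₁ optimal))
                (ℚₚ.≤-reflexive (trans (proj₂ optimal) (ℚₚ.+-identityʳ _)))

      lower : dp m n ℚ.≤ dtw² x y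
      lower with proj₁ (dtw²-isMinimum x y)
      ... | p , e = ℚₚ.≤-trans (dp≤cost p) (ℚₚ.≤-reflexive e)

-- Collapsing equal neighbours

module _ (f h g : ℕ → ℚ) (β : ℕ → ℕ) (β₀ : β 0 ≡ 0)
         (β⁺ : ∀ i → β (suc i) ≡ β i ⊎ β (suc i) ≡ suc (β i))
         (h∘β≗f : ∀ i → h (β i) ≡ f i) where

  private
    module f = Table f g
    module h = Table h g

    gap-β : ∀ i j → h.gap (β i) j ≡ f.gap i j
    gap-β i j = cong (λ a → (a ℚ.- g j) ℚ.* (a ℚ.- g j)) (h∘β≗f i)

  dp-compress : ∀ i j → h.dp (β i) j ℚ.≤ f.dp i j
  dp-compress = f.dp-greatest (λ i j → h.dp (β i) j) start s₁₀ s₀₁ s₁₁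
    where
    start : h.dp (β 0) 0 ℚ.≤ f.gap 0 0
    start = ℚₚ.≤-reflexive (trans (cong (λ b → h.dp b 0) β₀) (trans (ℚₚ.+-identityˡ _)
              (trans (cong (λ b → h.gap b 0) (sym β₀)) (gap-β 0 0))))

    s₁₀ : ∀ i j → h.dp (β (suc i)) j ℚ.≤ h.dp (β i) j ℚ.+ f.gap (suc i) j
    s₁₀ i j rewrite sym (gap-β (suc i) j) with β⁺ i
    ... | inj₁ e rewrite e = p≤p+q (h.gap-≥0 (β i) j)
    ... | inj₂ e rewrite e = h.dp-step₁₀ (β i) j

    s₀₁ : ∀ i j → h.dp (β i) (suc j) ℚ.≤ h.dp (β i) j ℚ.+ f.gap i (suc j)
    s₀₁ i j rewrite sym (gap-β i (suc j)) = h.dp-step₀₁ (β i) j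

    s₁₁ : ∀ i j → h.dp (β (suc i)) (suc j) ℚ.≤ h.dp (β i) j ℚ.+ f.gap (suc i) (suc j)
    s₁₁ i j rewrite sym (gap-β (suc i) (suc j)) with β⁺ i
    ... | inj₁ e rewrite e = h.dp-step₀₁ (β i) j
    ... | inj₂ e rewrite e = h.dp-step₁₁ (β i) j

-- Alternating series

alternate : Bool → ℕ → Bool
alternate b zero    = b
alternate b (suc i) = not (alternate b i)

-- The number of the block of equal entries that contains a position; this is the `β` of
-- `dp-compress`.
changes : (ℕ → Bool) → ℕ → ℕ
changes z zero    = 0
changes z (suc i) = if does (z i Bool.≟ z (suc i)) then changes z i else suc (changes z i)

changes-suc : ∀ z i → changes z (suc i) ≡ changes z i ⊎ changes z (suc i) ≡ suc (changes z i)
changes-suc z i with z i | z (suc i)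
... | false | false = inj₁ refl
... | false | true  = inj₂ refl
... | true  | false = inj₂ refl
... | true  | true  = inj₁ refl

alternate-changes : ∀ z i → alternate (z 0) (changes z i) ≡ z i
alternate-changes z zero    = refl
alternate-changes z (suc i) with z i | z (suc i) | alternate-changes z i
... | false | false | e = e
... | false | true  | e = cong not e
... | true  | false | e = cong not e
... | true  | true  | e = e

-- Defined by recursion so that `ι (suc i)` unfolds to the sum that the solver identities below
-- contain.
ι : ℕ → ℚ
ι zero    = 0ℚ
ι (suc n) = 1ℚ ℚ.+ ι n

ι-+ : ∀ m n → ι (m + n) ≡ ι m ℚ.+ ι n
ι-+ zero    n = sym (ℚₚ.+-identityˡ (ι n))
ι-+ (suc m) n = trans (cong (1ℚ ℚ.+_) (ι-+ m n)) (sym (ℚₚ.+-assoc 1ℚ (ι m) (ι n)))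

ι-mono : ∀ {m n} → m ≤ n → ι m ℚ.≤ ι n
ι-mono {n = zero}  z≤n     = ℚₚ.≤-refl
ι-mono {n = suc n} z≤n     = ℚₚ.≤-trans (ι-mono {n = n} z≤n)
  (subst (ℚ._≤ 1ℚ ℚ.+ ι n) (ℚₚ.+-identityˡ (ι n)) (ℚₚ.+-monoˡ-≤ (ι n) (ℚₚ.nonNegative⁻¹ 1ℚ)))
ι-mono             (s≤s h) = ℚₚ.+-monoʳ-≤ 1ℚ (ι-mono h)

½-≥0 : ∀ {p} → 0ℚ ℚ.≤ p → 0ℚ ℚ.≤ ½ ℚ.* p
½-≥0 {p} h = subst (ℚ._≤ ½ ℚ.* p) (ℚₚ.*-zeroʳ ½) (ℚₚ.*-monoˡ-≤-nonNeg ½ h)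

+-≥0 : ∀ {p q} → 0ℚ ℚ.≤ p → 0ℚ ℚ.≤ q → 0ℚ ℚ.≤ p ℚ.+ q
+-≥0 = ℚₚ.+-mono-≤

module _ (b : Bool) (x : ℕ → Bool) where

  private
    open Table (bit ∘ alternate b) (bit ∘ x)

    -- A vertical step is free on at most one of its two ends, so 2 dp − gap
    -- gains at least as much on it as i does; j pays for the other steps.
    r : ℕ → ℕ → ℚ
    r i j = ½ ℚ.* ((ι i ℚ.- ι j) ℚ.+ gap i j)

    gap-flip : ∀ i j → gap (suc i) j ≡ 1ℚ ℚ.- gap i j
    gap-flip i j with alternate b i | x j
    ... | false | false = refl
    ... | false | true  = refl
    ... | true  | false = refl
    ... | true  | true  = refl

    r≤dp : ∀ i j → r i j ℚ.≤ dp i j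
    r≤dp = dp-greatest r
      (0≤⇒≤ (subst (0ℚ ℚ.≤_)
        (solve 1 (λ c → con ½ :* c := c :- con ½ :* ((con 0ℚ :- con 0ℚ) :+ c)) refl (gap 0 0))
        (½-≥0 (gap-≥0 0 0))))
      -- The potential is tight on vertical steps: after `gap-flip` both sides are equal. With c and
      -- d the local costs at the two ends, a horizontal step leaves slack ½(1 + c + d) and a
      -- diagonal step ½(c + d).
      (λ i j → ℚₚ.≤-reflexive (trans (cong (λ c → ½ ℚ.* ((ι (suc i) ℚ.- ι j) ℚ.+ c)) (gap-flip i j))
        (trans (solve 3 (λ I J c →
            con ½ :* (((con 1ℚ :+ I) :- J) :+ (con 1ℚ :- c)) :=
            con ½ :* ((I :- J) :+ c) :+ (con 1ℚ :- c)) refl (ι i) (ι j) (gap i j))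
          (cong (r i j ℚ.+_) (sym (gap-flip i j))))))
      (λ i j → 0≤⇒≤ (subst (0ℚ ℚ.≤_)
        (solve 4 (λ I J c d →
            con ½ :* (con 1ℚ :+ (c :+ d)) :=
            (con ½ :* ((I :- J) :+ c) :+ d) :- con ½ :* ((I :- (con 1ℚ :+ J)) :+ d))
          refl (ι i) (ι j) (gap i j) (gap i (suc j)))
        (½-≥0 (+-≥0 (ℚₚ.nonNegative⁻¹ 1ℚ) (+-≥0 (gap-≥0 i j) (gap-≥0 i (suc j)))))))
      (λ i j → 0≤⇒≤ (subst (0ℚ ℚ.≤_)
        (solve 4 (λ I J c d →
            con ½ :* (c :+ d) :=
            (con ½ :* ((I :- J) :+ c) :+ d) :- con ½ :* (((con 1ℚ :+ I) :- (con 1ℚ :+ J)) :+ d))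
          refl (ι i) (ι j) (gap i j) (gap (suc i) (suc j)))
        (½-≥0 (+-≥0 (gap-≥0 i j) (gap-≥0 (suc i) (suc j))))))
      where open ℚSolver.+-*-Solver

  -- The potential `r` is at least ½(i - j). Intuitively, of two consecutive vertical steps one is
  -- paid, so each unit of cost takes two extra rows.
  dp-alternate-≥ : ∀ {i j} k → j + (k + k) ≤ i → ι k ℚ.≤ dp i j
  dp-alternate-≥ {i} {j} k h = ℚₚ.≤-trans (0≤⇒≤ (subst (0ℚ ℚ.≤_)
      (solve 4 (λ I J K c →
          con ½ :* ((I :- (J :+ (K :+ K))) :+ c) :=
          con ½ :* ((I :- J) :+ c) :- K) refl (ι i) (ι j) (ι k) (gap i j))
      (½-≥0 (+-≥0 (≤⇒0≤ ιi≥) (gap-≥0 i j))))) (r≤dp i j)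
    where
    open ℚSolver.+-*-Solver
    ιi≥ : ι j ℚ.+ (ι k ℚ.+ ι k) ℚ.≤ ι i
    ιi≥ = subst (ℚ._≤ ι i) (trans (ι-+ j (k + k)) (cong (ι j ℚ.+_) (ι-+ k k))) (ι-mono h)

module _ (f x : ℕ → Bool) where

  private
    open Table (bit ∘ f) (bit ∘ x)

    gap-≤1 : ∀ i j → gap i j ℚ.≤ 1ℚ
    gap-≤1 i j with f i | x j
    ... | false | false = ℚₚ.nonNegative⁻¹ 1ℚ
    ... | false | true  = ℚₚ.≤-refl
    ... | true  | false = ℚₚ.≤-refl
    ... | true  | true  = ℚₚ.nonNegative⁻¹ 1ℚ

  dp-row₀-≤ : ∀ j → dp 0 j ℚ.≤ ι (suc j)
  dp-row₀-≤ zero    = ℚₚ.≤-trans (ℚₚ.≤-reflexive (ℚₚ.+-comm 0ℚ (gap 0 0)))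
                                 (ℚₚ.+-monoˡ-≤ 0ℚ (gap-≤1 0 0))
  dp-row₀-≤ (suc j) = ℚₚ.≤-trans (ℚₚ.+-mono-≤ (dp-row₀-≤ j) (gap-≤1 0 (suc j)))
                                 (ℚₚ.≤-reflexive (ℚₚ.+-comm (ι (suc j)) 1ℚ))

-- Series as initial segments of infinite sequences

prefix : ∀ {A : Set} → (ℕ → A) → ℕ → List⁺ A
prefix f m = f 0 ∷ List.applyUpTo (f ∘ suc) m

lastIndex-⟦⟧ : ∀ z → lastIndex ⟦ z ⟧ ≡ lastIndex z
lastIndex-⟦⟧ (a ∷ as) = Listₚ.length-map bit as

lastIndex-prefix : ∀ (f : ℕ → Bool) m → lastIndex ⟦ prefix f m ⟧ ≡ m
lastIndex-prefix f m = trans (lastIndex-⟦⟧ (prefix f m)) (Listₚ.length-applyUpTo (f ∘ suc) m)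

prefix-! : ∀ f m i → bit (f (toℕ i)) ≡ ⟦ prefix f m ⟧ ! i
prefix-! f zero    Fin.zero    = refl
prefix-! f (suc m) Fin.zero    = refl
prefix-! f (suc m) (Fin.suc i) = prefix-! (f ∘ suc) m i

nth : ∀ {A : Set} → List⁺ A → ℕ → A
nth (a ∷ [])     _       = a
nth (a ∷ b ∷ bs) zero    = a
nth (a ∷ b ∷ bs) (suc i) = nth (b ∷ bs) i

nth-! : ∀ z i → bit (nth z (toℕ i)) ≡ ⟦ z ⟧ ! i
nth-! (a ∷ [])     Fin.zero    = refl
nth-! (a ∷ b ∷ bs) Fin.zero    = refl
nth-! (a ∷ b ∷ bs) (Fin.suc i) = nth-! (b ∷ bs) i

alternating : Bool → ℕ → BinarySeries
alternating b m = prefix (alternate b) m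

dtw²-alternating : ∀ b m y g → (∀ j → g (toℕ j) ≡ y ! j) →
  dtw² ⟦ alternating b m ⟧ y ≡ Table.dp (bit ∘ alternate b) g m (lastIndex y)
dtw²-alternating b m y g g≗y =
  trans (Table.dtw²≡dp (bit ∘ alternate b) g ⟦ alternating b m ⟧ y (prefix-! (alternate b) m) g≗y)
        (cong (λ i → Table.dp (bit ∘ alternate b) g i (lastIndex y)) (lastIndex-prefix (alternate b) m))

-- The quantifier over `x` is innermost because one alternating series has to serve all the samples
-- of a weighted sum simultaneously.
condense : ∀ z → ∃[ b ] ∃[ m ] (∀ x → dtw² ⟦ alternating b m ⟧ ⟦ x ⟧ ℚ.≤ dtw² ⟦ z ⟧ ⟦ x ⟧)
condense z = b , m , λ x → begin
  dtw² ⟦ alternating b m ⟧ ⟦ x ⟧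
    ≡⟨ dtw²-alternating b m ⟦ x ⟧ (bit ∘ nth x) (nth-! x) ⟩
  Table.dp (bit ∘ alternate b) (bit ∘ nth x) m (lastIndex ⟦ x ⟧)
    ≤⟨ dp-compress (bit ∘ nth z) (bit ∘ alternate b) (bit ∘ nth x) (changes (nth z)) refl
         (changes-suc (nth z)) (cong bit ∘ alternate-changes (nth z))
         (lastIndex ⟦ z ⟧) (lastIndex ⟦ x ⟧) ⟩
  Table.dp (bit ∘ nth z) (bit ∘ nth x) (lastIndex ⟦ z ⟧) (lastIndex ⟦ x ⟧)
    ≡⟨ Table.dtw²≡dp (bit ∘ nth z) (bit ∘ nth x) ⟦ z ⟧ ⟦ x ⟧ (nth-! z) (nth-! x) ⟨
  dtw² ⟦ z ⟧ ⟦ x ⟧ ∎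
  where
  open ℚₚ.≤-Reasoning
  b : Bool
  b = nth z 0
  m : ℕ
  m = changes (nth z) (lastIndex ⟦ z ⟧)

long-alternating : ∀ b {m} x → 3 * List⁺.length x ≤ m →
  dtw² ⟦ alternating false 0 ⟧ ⟦ x ⟧ ℚ.≤ dtw² ⟦ alternating b m ⟧ ⟦ x ⟧
long-alternating b {m} x h = begin
  dtw² ⟦ alternating false 0 ⟧ ⟦ x ⟧
    ≡⟨ dtw²-alternating false 0 ⟦ x ⟧ (bit ∘ nth x) (nth-! x) ⟩
  Table.dp (bit ∘ alternate false) (bit ∘ nth x) 0 n
    ≤⟨ dp-row₀-≤ (alternate false) (nth x) n ⟩
  ι (suc n)
    ≤⟨ dp-alternate-≥ b (nth x) (suc n) h′ ⟩
  Table.dp (bit ∘ alternate b) (bit ∘ nth x) m n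
    ≡⟨ dtw²-alternating b m ⟦ x ⟧ (bit ∘ nth x) (nth-! x) ⟨
  dtw² ⟦ alternating b m ⟧ ⟦ x ⟧ ∎
  where
  open ℚₚ.≤-Reasoning
  n : ℕ
  n = lastIndex ⟦ x ⟧
  -- Here `n` is a last index and `suc n` the length, so the left side is one less than three times
  -- the length.
  h′ : n + (suc n + suc n) ≤ m
  h′ rewrite lastIndex-⟦⟧ x = ≤-trans (+-mono-≤ (n≤1+n (lastIndex x))
    (+-monoʳ-≤ (suc (lastIndex x)) (≤-reflexive (sym (+-identityʳ _))))) h

-- Program logic with frames and time bounds

module _ {A : Set} (μ : Memory A) (a i j : ℕ) (v : A) where

  update-hit : (μ [ a , i , j ]≔ v) a i j ≡ v
  update-hit rewrite dec-true (a ≟ a ×-dec i ≟ i ×-dec j ≟ j) (refl , refl , refl) = refl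

  update-miss : ∀ {b i′ j′} → ¬ (b ≡ a × i′ ≡ i × j′ ≡ j) → (μ [ a , i , j ]≔ v) b i′ j′ ≡ μ b i′ j′
  update-miss {b} {i′} {j′} ≢ rewrite dec-false (b ≟ a ×-dec i′ ≟ i ×-dec j′ ≟ j) ≢ = refl

-- Whole arrays are tracked, not cells. This is coarse, but it computes: for a concrete program and
-- name, the condition of a frame is proved by `refl`.
writesℕ writesℚ : Program → Name → Bool
writesℕ skip              b = false
writesℕ (assignℕ a _ _ _) b = does (b ≟ a)
writesℕ (assignℚ _ _ _ _) b = false
writesℕ (π ⨾ ρ)           b = writesℕ π b ∨ writesℕ ρ b
writesℕ (branch _ π ρ)    b = writesℕ π b ∨ writesℕ ρ b
writesℕ (while _ π)       b = writesℕ π b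
writesℚ skip              b = false
writesℚ (assignℕ _ _ _ _) b = false
writesℚ (assignℚ a _ _ _) b = does (b ≟ a)
writesℚ (π ⨾ ρ)           b = writesℚ π b ∨ writesℚ ρ b
writesℚ (branch _ π ρ)    b = writesℚ π b ∨ writesℚ ρ b
writesℚ (while _ π)       b = writesℚ π b

∨-false : ∀ {a b} → a ∨ b ≡ false → a ≡ false × b ≡ false
∨-false {false} {false} _ = refl , refl

≟-false : ∀ {m n} → does (m ≟ n) ≡ false → m ≢ n
≟-false {m} {n} e m≡n with trans (sym e) (dec-true (m ≟ n) m≡n)
... | ()

record Frame (π : Program) (σ σ′ : State) : Set where
  field
    natKept : ∀ b → writesℕ π b ≡ false → ∀ i j → nat σ′ b i j ≡ nat σ b i j
    ratKept : ∀ b → writesℚ π b ≡ false → ∀ i j → rat σ′ b i j ≡ rat σ b i j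

open Frame

frame-trans : ∀ {π σ σ′ σ″} → Frame π σ σ′ → Frame π σ′ σ″ → Frame π σ σ″
natKept (frame-trans f g) b e i j = trans (natKept g b e i j) (natKept f b e i j)
ratKept (frame-trans f g) b e i j = trans (ratKept g b e i j) (ratKept f b e i j)

frame-refl : ∀ {π σ} → Frame π σ σ
natKept frame-refl _ _ _ _ = refl
ratKept frame-refl _ _ _ _ = refl

frame-⨾ˡ : ∀ {π ρ σ σ′} → Frame π σ σ′ → Frame (π ⨾ ρ) σ σ′
natKept (frame-⨾ˡ f) b = natKept f b ∘ proj₁ ∘ ∨-false
ratKept (frame-⨾ˡ f) b = ratKept f b ∘ proj₁ ∘ ∨-false

frame-⨾ʳ : ∀ {π ρ σ σ′} → Frame ρ σ σ′ → Frame (π ⨾ ρ) σ σ′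
natKept (frame-⨾ʳ {π} f) b = natKept f b ∘ proj₂ ∘ ∨-false {writesℕ π b}
ratKept (frame-⨾ʳ {π} f) b = ratKept f b ∘ proj₂ ∘ ∨-false {writesℚ π b}

frame : ∀ {π σ σ′ t} → π , σ ⇓ σ′ # t → Frame π σ σ′
frame ⇓skip = frame-refl
natKept (frame (⇓assignℕ {a} {σ = σ})) b e i j = update-miss (nat σ) a _ _ _ (≟-false e ∘ proj₁)
ratKept (frame (⇓assignℕ {a})) b e i j = refl
natKept (frame (⇓assignℚ {a})) b e i j = refl
ratKept (frame (⇓assignℚ {a} {σ = σ})) b e i j = update-miss (rat σ) a _ _ _ (≟-false e ∘ proj₁)
frame (⇓⨾ {π} {ρ} d d′) = frame-trans {π ⨾ ρ} (frame-⨾ˡ (frame d)) (frame-⨾ʳ {π} (frame d′))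
natKept (frame (⇓branch-true {π = π} _ d)) b = natKept (frame d) b ∘ proj₁ ∘ ∨-false {writesℕ π b}
ratKept (frame (⇓branch-true {π = π} _ d)) b = ratKept (frame d) b ∘ proj₁ ∘ ∨-false {writesℚ π b}
natKept (frame (⇓branch-false {π = π} _ d)) b = natKept (frame d) b ∘ proj₂ ∘ ∨-false {writesℕ π b}
ratKept (frame (⇓branch-false {π = π} _ d)) b = ratKept (frame d) b ∘ proj₂ ∘ ∨-false {writesℚ π b}
frame (⇓while-true {b} {π} _ d d′) with frame d | frame d′
... | f | g = record { natKept = natKept h ; ratKept = ratKept h }
  where
  h = frame-trans {while b π} (record { natKept = natKept f ; ratKept = ratKept f }) g
frame (⇓while-false _) = frame-refl

-- A total-correctness triple with a time bound. The initial state is fixed, so preconditions are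
-- ordinary hypotheses about `σ`, and `Q` may mention `σ`.
record Run (π : Program) (σ : State) (Q : State → Set) (T : ℕ) : Set where
  constructor run
  field
    {final} : State
    {ops}   : ℕ
    halts   : π , σ ⇓ final # ops
    post    : Q final
    bound   : ops ≤ T

weaken : ∀ {π σ P Q S T} → (∀ {σ′} → Frame π σ σ′ → P σ′ → Q σ′) → S ≤ T →
         Run π σ P S → Run π σ Q T
weaken P⇒Q S≤T (run d p t≤) = run d (P⇒Q (frame d) p) (≤-trans t≤ S≤T)

skip-run : ∀ {σ Q} → Q σ → Run skip σ Q 0
skip-run q = run ⇓skip q z≤n

assignℕ-run : ∀ {a d e v σ Q} → Q ⟨ nat σ [ a , evalℕ d σ , evalℕ e σ ]≔ evalℕ v σ , rat σ ⟩ →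
              Run (assignℕ a d e v) σ Q (opsℕ d + opsℕ e + opsℕ v)
assignℕ-run q = run ⇓assignℕ q ≤-refl

assignℚ-run : ∀ {a d e v σ Q} → Q ⟨ nat σ , rat σ [ a , evalℕ d σ , evalℕ e σ ]≔ evalℚ v σ ⟩ →
              Run (assignℚ a d e v) σ Q (opsℕ d + opsℕ e + opsℚ v)
assignℚ-run q = run ⇓assignℚ q ≤-refl

⨾-run : ∀ {π ρ σ P Q S T} → Run π σ P S → (∀ {σ′} → Frame π σ σ′ → P σ′ → Run ρ σ′ Q T) →
        Run (π ⨾ ρ) σ Q (S + T)
⨾-run (run d p s≤) k with k (frame d) p
... | run d′ q t≤ = run (⇓⨾ d d′) q (+-mono-≤ s≤ t≤)

assignℕ-⨾-run : ∀ {a d e v ρ σ Q T} →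
  Run ρ ⟨ nat σ [ a , evalℕ d σ , evalℕ e σ ]≔ evalℕ v σ , rat σ ⟩ Q T →
  Run (assignℕ a d e v ⨾ ρ) σ Q (opsℕ d + opsℕ e + opsℕ v + T)
assignℕ-⨾-run (run d q t≤) = run (⇓⨾ ⇓assignℕ d) q (+-monoʳ-≤ _ t≤)

assignℚ-⨾-run : ∀ {a d e v ρ σ Q T} →
  Run ρ ⟨ nat σ , rat σ [ a , evalℕ d σ , evalℕ e σ ]≔ evalℚ v σ ⟩ Q T →
  Run (assignℚ a d e v ⨾ ρ) σ Q (opsℕ d + opsℕ e + opsℚ v + T)
assignℚ-⨾-run (run d q t≤) = run (⇓⨾ ⇓assignℚ d) q (+-monoʳ-≤ _ t≤)

branch-yes : ∀ {d e π ρ σ Q T} → evalℕ d σ ≤ evalℕ e σ → Run π σ Q T →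
             Run (branch (d ≤ℕ e) π ρ) σ Q (opsTest (d ≤ℕ e) + T)
branch-yes h (run d q t≤) = run (⇓branch-true (dec-true (_ ≤? _) h) d) q (+-monoʳ-≤ _ t≤)

branch-no : ∀ {d e π ρ σ Q T} → ¬ evalℕ d σ ≤ evalℕ e σ → Run ρ σ Q T →
            Run (branch (d ≤ℕ e) π ρ) σ Q (opsTest (d ≤ℕ e) + T)
branch-no h (run d q t≤) = run (⇓branch-false (dec-false (_ ≤? _) h) d) q (+-monoʳ-≤ _ t≤)

branchℚ-run : ∀ {d e π ρ σ Q T} →
              (evalℚ d σ ℚ.≤ evalℚ e σ → Run π σ Q T) →
              (¬ evalℚ d σ ℚ.≤ evalℚ e σ → Run ρ σ Q T) →
              Run (branch (d ≤ℚ e) π ρ) σ Q (opsTest (d ≤ℚ e) + T)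
branchℚ-run {d} {e} {σ = σ} y n with evalℚ d σ ℚ.≤? evalℚ e σ
... | yes h with y h
...   | run r q t≤ = run (⇓branch-true (dec-true (_ ℚ.≤? _) h) r) q (+-monoʳ-≤ _ t≤)
branchℚ-run y n | no h with n h
...   | run r q t≤ = run (⇓branch-false (dec-false (_ ℚ.≤? _) h) r) q (+-monoʳ-≤ _ t≤)

var : Name → ℕExpr
var a = read a (lit 0) (lit 0)

varℚ : Name → ℚExpr
varℚ a = read a (lit 0) (lit 0)

infix 6 _≔ℕ_ _≔ℚ_

_≔ℕ_ : Name → ℕExpr → Program
a ≔ℕ v = assignℕ a (lit 0) (lit 0) v

_≔ℚ_ : Name → ℚExpr → Program
a ≔ℚ v = assignℚ a (lit 0) (lit 0) v

-- Tests offer only ≤, so the strict comparison of the counter with `e` is written with an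
-- increment.
for : Name → ℕExpr → Program → Program
for c e π = c ≔ℕ lit 0 ⨾ while (op add (var c) (lit 1) ≤ℕ e) (π ⨾ c ≔ℕ op add (var c) (lit 1))

setℕ : Name → ℕ → State → State
setℕ c v σ = ⟨ nat σ [ c , 0 , 0 ]≔ v , rat σ ⟩

-- The body must establish the invariant in the very state that the increment of the counter
-- produces, so that the increment itself calls for no further argument. The frame since the loop
-- was entered is handed to the body, which keeps facts about untouched arrays out of the
-- invariants.
module _ {c e π σ n T} (I : ℕ → State → Set)
         (e-ops : opsℕ e ≤ 1) (c-kept : writesℕ π c ≡ false)
         (e≡n : ∀ {σ′} → Frame (for c e π) σ σ′ → evalℕ e σ′ ≡ n)
         (initial : I 0 (setℕ c 0 σ))
         (body : ∀ {i σ′} → i < n → Frame (for c e π) σ σ′ → nat σ′ c 0 0 ≡ i → I i σ′ →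
                 Run π σ′ (λ σ″ → I (suc i) (setℕ c (nat σ″ c 0 0 + 1) σ″)) T)
         where

  private
    test : Test
    test = op add (var c) (lit 1) ≤ℕ e

    loop : Program
    loop = while test (π ⨾ c ≔ℕ op add (var c) (lit 1))

    opsTest≤ : opsTest test ≤ 3
    opsTest≤ = +-monoʳ-≤ 2 e-ops

    -- Induction on the number of rounds left. A round adds at most 3 operations for the test and 1
    -- for the increment to the time of the body; the leading 3 pays for the last test, which fails.
    iterate : ∀ k {i σ′} → i + k ≡ n → Frame (for c e π) σ σ′ → nat σ′ c 0 0 ≡ i → I i σ′ →
              Run loop σ′ (I n) (3 + k * (4 + T))
    iterate zero {i} {σ′} i+0≡n fr c≡i inv =
      run (⇓while-false (dec-false (_ ≤? _) done)) (subst (λ i → I i σ′) i≡n inv)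
          (≤-trans opsTest≤ (m≤m+n 3 0))
      where
      i≡n : i ≡ n
      i≡n = trans (sym (+-identityʳ i)) i+0≡n
      done : ¬ nat σ′ c 0 0 + 1 ≤ evalℕ e σ′
      done h rewrite e≡n fr | c≡i | i≡n | +-comm n 1 = 1+n≰n h
    iterate (suc k) {i} {σ′} i+k≡n fr c≡i inv
      with body (subst (i <_) i+k≡n (m<m+n i (s≤s z≤n))) fr c≡i inv
    ... | run {σ″} {t} d inv′ t≤ with iterate k (trans (sym (+-suc i k)) i+k≡n) fr″ c≡′ inv′
      where
      d⁺ : π ⨾ c ≔ℕ op add (var c) (lit 1) , σ′ ⇓ setℕ c (nat σ″ c 0 0 + 1) σ″ # t + 1
      d⁺ = ⇓⨾ d ⇓assignℕ
      fr″ : Frame (for c e π) σ (setℕ c (nat σ″ c 0 0 + 1) σ″)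
      fr″ = frame-trans {for c e π} fr (frame-⨾ʳ {c ≔ℕ lit 0}
        (record { natKept = natKept (frame d⁺) ; ratKept = ratKept (frame d⁺) }))
      c≡′ : nat (setℕ c (nat σ″ c 0 0 + 1) σ″) c 0 0 ≡ suc i
      c≡′ = trans (update-hit (nat σ″) c 0 0 _)
        (trans (cong (_+ 1) (trans (natKept (frame d) c c-kept 0 0) c≡i)) (+-comm i 1))
    ...   | run d′ q u≤ = run (⇓while-true (dec-true (_ ≤? _) more) (⇓⨾ d ⇓assignℕ) d′) q (begin
        opsTest test + (t + 1) + _
          ≤⟨ +-mono-≤ (+-mono-≤ opsTest≤ (+-monoˡ-≤ 1 t≤)) u≤ ⟩
        3 + (T + 1) + (3 + k * (4 + T))
          ≡⟨ solve 2 (λ T K → con 3 :+ (T :+ con 1) :+ (con 3 :+ K) :=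
               con 3 :+ ((con 4 :+ T) :+ K)) refl T (k * (4 + T)) ⟩
        3 + suc k * (4 + T)
          ∎)
      where
      open ≤-Reasoning
      open ℕSolver.+-*-Solver
      more : nat σ′ c 0 0 + 1 ≤ evalℕ e σ′
      more rewrite e≡n fr | c≡i | +-comm i 1 = subst (i <_) i+k≡n (m<m+n i (s≤s z≤n))

  -- As N and T are positive, the overhead fits into the product: 3 for the failing test, 4 for each
  -- round and 1 for the body make 8. A pure product lets the bounds of nested loops multiply.
  for-run : ∀ {N} → n ≤ N → 1 ≤ N → 1 ≤ T → Run (for c e π) σ (I n) (8 * (N * T))
  for-run {N} n≤N 1≤N 1≤T = weaken (λ _ q → q) time
    (assignℕ-⨾-run (iterate n refl (frame-⨾ˡ (frame (⇓assignℕ {c} {lit 0} {lit 0} {lit 0})))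
      (update-hit (nat σ) c 0 0 0) initial))
    where
    open ≤-Reasoning
    open ℕSolver.+-*-Solver
    time : 3 + n * (4 + T) ≤ 8 * (N * T)
    time = begin
      3 + n * (4 + T)
        ≤⟨ +-mono-≤ (*-monoʳ-≤ 3 (*-mono-≤ 1≤N 1≤T)) (*-mono-≤ n≤N (+-monoˡ-≤ T (*-monoʳ-≤ 4 1≤T))) ⟩
      3 * (N * T) + N * (4 * T + T)
        ≡⟨ solve 2 (λ N T → con 3 :* (N :* T) :+ N :* (con 4 :* T :+ T) :=
             con 8 :* (N :* T)) refl N T ⟩
      8 * (N * T)
        ∎

-- The program

-- Names 0 to 2 of either kind are those of the input and output conventions.

vSize vLength vOut vBound vSeries vLast vRow vColumn vPosition : Name
vSize     = 0
vLength   = 1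
vOut      = 2
vBound    = 3
vSeries   = 4
vLast     = 5
vRow      = 6
vColumn   = 7
vPosition = 8

vWeight vSample vMean vSeq vTable vLeast vTotal vBest : Name
vWeight = 0
vSample = 1
vMean   = 2
vSeq    = 3
vTable  = 4
vLeast  = 5
vTotal  = 6
vBest   = 7

entry : ℕExpr → ℕExpr → ℚExpr
entry = read vTable

plus1 minus1 : ℕExpr → ℕExpr
plus1  e = op add e (lit 1)
minus1 e = op monus e (lit 1)

sampleLength : ℕExpr
sampleLength = read vLength (var vSeries) (lit 0)

lower : ℚExpr → Program
lower e = branch (e ≤ℚ varℚ vLeast) (vLeast ≔ℚ e) skip

predecessor : Program
predecessor = branch (lit 1 ≤ℕ var vRow)
  (branch (lit 1 ≤ℕ var vColumn)
    (vLeast ≔ℚ entry (minus1 (var vRow)) (minus1 (var vColumn)) ⨾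
     lower (entry (minus1 (var vRow)) (var vColumn)) ⨾
     lower (entry (var vRow) (minus1 (var vColumn))))
    (vLeast ≔ℚ entry (minus1 (var vRow)) (var vColumn)))
  (branch (lit 1 ≤ℕ var vColumn)
    (vLeast ≔ℚ entry (var vRow) (minus1 (var vColumn)))
    (vLeast ≔ℚ lit 0ℚ))

difference : ℚExpr
difference = op sub (read vSeq (lit 0) (var vRow)) (read vSample (var vSeries) (var vColumn))

cell : Program
cell = predecessor ⨾
  assignℚ vTable (var vRow) (var vColumn) (op add (varℚ vLeast) (op mul difference difference))

fillRow fillTable accumulate evaluate : Program
fillRow    = for vColumn sampleLength cell
fillTable  = for vRow (plus1 (var vLast)) fillRow
accumulate = fillTable ⨾ vTotal ≔ℚ op add (varℚ vTotal)
  (op mul (read vWeight (lit 0) (var vSeries)) (entry (var vLast) (minus1 sampleLength)))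
evaluate   = vTotal ≔ℚ lit 0ℚ ⨾ for vSeries (var vSize) accumulate

-- An alternating series is determined by its first entry and its length, so keeping one takes a
-- single operation. Candidates with the same first entry are prefixes of each other, so the next
-- one takes a single new entry.
keep extendSeq : Program
keep      = vBest ≔ℚ varℚ vTotal ⨾ vOut ≔ℕ plus1 (var vLast) ⨾ vMean ≔ℚ read vSeq (lit 0) (lit 0)
extendSeq = assignℚ vSeq (lit 0) (plus1 (var vLast)) (op sub (lit 1ℚ) (read vSeq (lit 0) (var vLast)))

-- The maximum l ⊔ m is computed as m + (l ∸ m).  writeMean fills one cell
-- beyond the mean, which Output leaves unspecified.

measure firstCandidate candidates writeMean : Program
measure = vBound ≔ℕ lit 0 ⨾
  for vSeries (var vSize) (vBound ≔ℕ op add (var vBound) (op monus sampleLength (var vBound))) ⨾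
  vBound ≔ℕ op add (var vBound) (op add (var vBound) (var vBound))
firstCandidate = vSeq ≔ℚ lit 0ℚ ⨾ vLast ≔ℕ lit 0 ⨾ evaluate ⨾ keep
candidates = for vLast (var vBound)
  (evaluate ⨾ branch (varℚ vTotal ≤ℚ varℚ vBest) keep skip ⨾ extendSeq)
writeMean = for vPosition (var vOut)
  (assignℚ vMean (lit 0) (plus1 (var vPosition))
    (op sub (lit 1ℚ) (read vMean (lit 0) (var vPosition))))

binaryMean : Program
binaryMean = measure ⨾ firstCandidate ⨾
  (vSeq ≔ℚ lit (bit false) ⨾ candidates) ⨾ (vSeq ≔ℚ lit (bit true) ⨾ candidates) ⨾ writeMean

-- Correctness of the program

lower-run : ∀ {e σ a b} → evalℚ e σ ≡ b → rat σ vLeast 0 0 ≡ a →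
            Run (lower e) σ (λ σ′ → rat σ′ vLeast 0 0 ≡ a ⊓ b) (suc (opsℚ e + 0) + opsℚ e)
lower-run {e} {σ} {a} {b} refl refl = branchℚ-run {T = opsℚ e}
  (λ b≤a → assignℚ-run (sym (ℚₚ.p≥q⇒p⊓q≡q b≤a)))
  (λ b≰a → weaken (λ _ q → q) z≤n (skip-run (sym (ℚₚ.p≤q⇒p⊓q≡p (ℚₚ.<⇒≤ (ℚₚ.≰⇒> b≰a))))))

module Cell (f g : ℕ → ℚ) where
  open Table f g

  -- Speaks only of the part already filled: elsewhere the table may still hold values for earlier
  -- samples and candidates.
  Row : ℕ → ℕ → State → Set
  Row p n σ = ∀ {q} → q < n → rat σ vTable p q ≡ dp p q

  Rows : ℕ → ℕ → State → Set
  Rows m n σ = ∀ {p} → p < m → Row p n σ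

  -- An interior cell is the worst case: two tests, two decrements in the first read, and three
  -- operations for each of the two uses of `lower`.
  predecessor-run : ∀ {p q n σ} → nat σ vRow 0 0 ≡ p → nat σ vColumn 0 0 ≡ q → q < n →
                    Rows p n σ → Row p q σ →
                    Run predecessor σ (λ σ′ → rat σ′ vLeast 0 0 ≡ before p q) 10
  predecessor-run {p} {q} {n} {σ} p≡ q≡ q<n rows row = go p≡ q≡ q<n rows row
    where
    Goal : ℕ → ℕ → Set
    Goal p q = Run predecessor σ (λ σ′ → rat σ′ vLeast 0 0 ≡ before p q) 10

    1≰ : ∀ {n} → n ≡ 0 → ¬ 1 ≤ n
    1≰ refl ()

    1≤ : ∀ {m n} → m ≡ suc n → 1 ≤ m
    1≤ refl = s≤s z≤n

    go : ∀ {p q} → nat σ vRow 0 0 ≡ p → nat σ vColumn 0 0 ≡ q → q < n → Rows p n σ → Row p q σ → Goal p q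
    go {zero} {zero} p≡ q≡ q<n rows row = weaken (λ _ r → r) (≤ᵇ⇒≤ _ 10 _)
      (branch-no (1≰ p≡) (branch-no (1≰ q≡) (assignℚ-run refl)))
    go {zero} {suc q} p≡ q≡ q<n rows row = weaken (λ _ r → r) (≤ᵇ⇒≤ _ 10 _)
      (branch-no (1≰ p≡) (branch-yes (1≤ q≡) (assignℚ-run
        (trans (cong₂ (rat σ vTable) p≡ (cong (_∸ 1) q≡)) (row (n<1+n q))))))
    go {suc p} {zero} p≡ q≡ q<n rows row = weaken (λ _ r → r) (≤ᵇ⇒≤ _ 10 _)
      (branch-yes (1≤ p≡) (branch-no (1≰ q≡) (assignℚ-run
        (trans (cong₂ (rat σ vTable) (cong (_∸ 1) p≡) q≡) (rows (n<1+n p) q<n)))))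
    go {suc p} {suc q} p≡ q≡ q<n rows row = weaken (λ _ r → r) (≤ᵇ⇒≤ _ 10 _)
      (branch-yes (1≤ p≡) (branch-yes (1≤ q≡) (assignℚ-⨾-run (⨾-run
        (lower-run (trans (cong₂ (rat σ vTable) (cong (_∸ 1) p≡) q≡) (rows (n<1+n p) q<n))
          (trans (cong₂ (rat σ vTable) (cong (_∸ 1) p≡) (cong (_∸ 1) q≡))
            (rows (n<1+n p) (<-trans (n<1+n q) q<n))))
        λ {σ′} fr → lower-run (begin
          rat σ′ vTable (nat σ′ vRow 0 0) (nat σ′ vColumn 0 0 ∸ 1)
            ≡⟨ ratKept fr vTable refl _ _ ⟩
          rat σ vTable (nat σ′ vRow 0 0) (nat σ′ vColumn 0 0 ∸ 1)
            ≡⟨ cong₂ (rat σ vTable) (trans (natKept fr vRow refl 0 0) p≡)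
                 (cong (_∸ 1) (trans (natKept fr vColumn refl 0 0) q≡)) ⟩
          rat σ vTable (suc p) q
            ≡⟨ row (n<1+n q) ⟩
          dp (suc p) q ∎)))))
      where open ≡-Reasoning

  cell-run : ∀ {p q n σ} → nat σ vRow 0 0 ≡ p → nat σ vColumn 0 0 ≡ q → q < n →
             rat σ vSeq 0 p ≡ f p → rat σ vSample (nat σ vSeries 0 0) q ≡ g q →
             Rows p n σ → Row p q σ →
             Run cell σ (λ σ′ → Rows p n σ′ × Row p (suc q) σ′) 14
  cell-run {p} {q} {n} {σ} p≡ q≡ q<n f≡ g≡ rows row =
    ⨾-run (predecessor-run p≡ q≡ q<n rows row) store
    where
    store : ∀ {σ′} → Frame predecessor σ σ′ → rat σ′ vLeast 0 0 ≡ before p q →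
            Run (assignℚ vTable (var vRow) (var vColumn) _) σ′ (λ σ′ → Rows p n σ′ × Row p (suc q) σ′) 4
    store {σ′} fr least≡ =
      assignℚ-run ((λ i<p j<n → old (<⇒≢ i<p ∘ proj₁) (rows i<p j<n)) , row′)
      where
      p≡′ : nat σ′ vRow 0 0 ≡ p
      p≡′ = trans (natKept fr vRow refl 0 0) p≡

      q≡′ : nat σ′ vColumn 0 0 ≡ q
      q≡′ = trans (natKept fr vColumn refl 0 0) q≡

      difference≡ : evalℚ difference σ′ ≡ f p ℚ.- g q
      difference≡ = cong₂ ℚ._-_
        (trans (ratKept fr vSeq refl _ _) (trans (cong (rat σ vSeq 0) p≡′) f≡))
        (trans (ratKept fr vSample refl _ _)
          (trans (cong₂ (rat σ vSample) (natKept fr vSeries refl 0 0) q≡′) g≡))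

      v : ℚ
      v = evalℚ (op add (varℚ vLeast) (op mul difference difference)) σ′

      τ : Memory ℚ
      τ = rat σ′ [ vTable , nat σ′ vRow 0 0 , nat σ′ vColumn 0 0 ]≔ v

      new : τ vTable p q ≡ dp p q
      new = trans (cong₂ (λ i j → (rat σ′ [ vTable , i , j ]≔ v) vTable p q) p≡′ q≡′)
              (trans (update-hit (rat σ′) vTable p q v)
                (cong₂ ℚ._+_ least≡ (cong₂ ℚ._*_ difference≡ difference≡)))

      old : ∀ {i j} → ¬ (i ≡ p × j ≡ q) → rat σ vTable i j ≡ dp i j → τ vTable i j ≡ dp i j
      old ≢ e = trans
        (update-miss (rat σ′) vTable _ _ v λ { (_ , a , b) → ≢ (trans a p≡′ , trans b q≡′) })
        (trans (ratKept fr vTable refl _ _) e)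

      row′ : ∀ {j} → j < suc q → τ vTable p j ≡ dp p j
      row′ {j} j< with j ≟ q
      ... | yes refl = new
      ... | no j≢q   = old (j≢q ∘ proj₂) (row (≤∧≢⇒< (≤-pred j<) j≢q))

  rows-snoc : ∀ {p n σ} → Rows p n σ → Row p n σ → Rows (suc p) n σ
  rows-snoc {p} rows row {i} i< with i ≟ p
  ... | yes refl = row
  ... | no  i≢p  = rows (≤∧≢⇒< (≤-pred i<) i≢p)

  fillRow-run : ∀ {p n N σ} → nat σ vRow 0 0 ≡ p → evalℕ sampleLength σ ≡ n →
                rat σ vSeq 0 p ≡ f p → (∀ q → rat σ vSample (nat σ vSeries 0 0) q ≡ g q) →
                n ≤ N → 1 ≤ N → Rows p n σ →
                Run fillRow σ (Rows (suc p) n) (8 * (N * 14))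
  fillRow-run {p} {n} {N} {σ} p≡ n≡ f≡ g≡ n≤N 1≤N rows =
    weaken (λ {σ′} _ (rs , r) → rows-snoc {σ = σ′} rs r) ≤-refl
      (for-run {c = vColumn} (λ q σ → Rows p n σ × Row p q σ) z≤n refl
        (λ {σ′} fr → trans (natKept fr vLength refl _ 0)
          (trans (cong (λ i → nat σ vLength i 0) (natKept fr vSeries refl 0 0)) n≡))
        (rows , λ ())
        (λ {q} {σ′} q<n fr q≡ (rs , r) → cell-run
          (trans (natKept fr vRow refl 0 0) p≡) q≡ q<n
          (trans (ratKept fr vSeq refl 0 p) f≡)
          (trans (ratKept fr vSample refl _ q)
            (trans (cong (λ i → rat σ vSample i q) (natKept fr vSeries refl 0 0)) (g≡ q)))
          rs r)
        n≤N 1≤N (≤ᵇ⇒≤ 1 14 _))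

  fillTable-run : ∀ {m n N σ} → nat σ vLast 0 0 ≡ m → evalℕ sampleLength σ ≡ n →
                  (∀ {j} → j ≤ m → rat σ vSeq 0 j ≡ f j) →
                  (∀ q → rat σ vSample (nat σ vSeries 0 0) q ≡ g q) →
                  suc m ≤ N → n ≤ N →
                  Run fillTable σ (Rows (suc m) n) (8 * (N * (8 * (N * 14))))
  fillTable-run {m} {n} {N} {σ} m≡ n≡ f≡ g≡ m<N n≤N =
    for-run {c = vRow} (λ p → Rows p n) (s≤s z≤n) refl
      (λ fr → trans (cong (_+ 1) (trans (natKept fr vLast refl 0 0) m≡)) (+-comm m 1))
      (λ ())
      (λ {p} {σ′} p<m fr p≡ rows → fillRow-run p≡
        (trans (natKept fr vLength refl _ 0)
          (trans (cong (λ i → nat σ vLength i 0) (natKept fr vSeries refl 0 0)) n≡))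
        (trans (ratKept fr vSeq refl 0 p) (f≡ (≤-pred p<m)))
        (λ q → trans (ratKept fr vSample refl _ q)
          (trans (cong (λ i → rat σ vSample i q) (natKept fr vSeries refl 0 0)) (g≡ q)))
        n≤N 1≤N rows)
      m<N 1≤N (≤-trans (s≤s z≤n) (*-monoʳ-≤ 8 (*-monoˡ-≤ 14 1≤N)))
    where
    1≤N : 1 ≤ N
    1≤N = ≤-trans (s≤s z≤n) m<N

-- Scores of candidates and their evaluation

Σ< : (ℕ → ℚ) → ℕ → ℚ
Σ< f zero    = 0ℚ
Σ< f (suc n) = Σ< f n ℚ.+ f n

accumulateTime : ℕ → ℕ
accumulateTime N = 8 * (N * (8 * (N * 14))) + 3

evaluateTime : ℕ → ℕ → ℕ
evaluateTime k N = 8 * (k * accumulateTime N)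

measureTime meanTime : ℕ → ℕ
measureTime k = 8 * (k * 2) + 2
meanTime    N = 8 * (N * 2)

module Problem (k : ℕ) (length : ℕ → ℕ) (weight : ℕ → ℚ) (sample : ℕ → ℕ → ℚ) where

  -- The conditions range over all indices, also beyond the sample: the parameters will be the
  -- initial contents of the memory itself, whatever it holds there.
  record Given (σ : State) : Set where
    field
      size    : nat σ vSize 0 0 ≡ k
      lengths : ∀ i → nat σ vLength i 0 ≡ length i
      weights : ∀ i → rat σ vWeight 0 i ≡ weight i
      samples : ∀ i j → rat σ vSample i j ≡ sample i j

  open Given

  given-kept : ∀ {π σ σ′} → writesℕ π vSize ≡ false → writesℕ π vLength ≡ false →
               writesℚ π vWeight ≡ false → writesℚ π vSample ≡ false →
               Frame π σ σ′ → Given σ → Given σ′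
  size    (given-kept a b c d fr h)     = trans (natKept fr vSize a 0 0) (size h)
  lengths (given-kept a b c d fr h) i   = trans (natKept fr vLength b i 0) (lengths h i)
  weights (given-kept a b c d fr h) i   = trans (ratKept fr vWeight c 0 i) (weights h i)
  samples (given-kept a b c d fr h) i j = trans (ratKept fr vSample d i j) (samples h i j)

  -- The maximum is characterised as a least upper bound, so the order in which the loop visits the
  -- samples need not be matched with the fold in `maxLength`.
  measure-run : ∀ {n σ} → 1 ≤ k → Given σ → (∀ {i} → i < k → length i ≤ n) →
                (∀ {l} → (∀ {i} → i < k → length i ≤ l) → n ≤ l) →
                Run measure σ (λ σ′ → nat σ′ vBound 0 0 ≡ n + (n + n)) (measureTime k)
  measure-run {n} {σ} 1≤k h upper lub = assignℕ-⨾-run (⨾-run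
    (for-run {c = vSeries} I z≤n refl
      (λ fr → trans (natKept fr vSize refl 0 0) (Given.size h))
      ((λ ()) , z≤n) body ≤-refl 1≤k (s≤s z≤n))
    λ fr (all , max) → assignℕ-run (cong (λ m → m + (m + m)) (≤-antisym max (lub all))))
    where
    I : ℕ → State → Set
    I i σ = (∀ {j} → j < i → length j ≤ nat σ vBound 0 0) × nat σ vBound 0 0 ≤ n

    body : ∀ {i σ′} → i < k → Frame _ _ σ′ → nat σ′ vSeries 0 0 ≡ i → I i σ′ → Run _ σ′ _ 2
    body {i} {σ′} i<k fr i≡ (all , max) = assignℕ-run (subst new (sym length≡) new-i)
      where
      m : ℕ
      m = nat σ′ vBound 0 0

      length≡ : evalℕ sampleLength σ′ ≡ length i
      length≡ = trans (natKept fr vLength refl _ 0)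
        (trans (cong (λ i → nat σ vLength i 0) i≡) (Given.lengths h i))

      new : ℕ → Set
      new l = (∀ {j} → j < suc i → length j ≤ m + (l ∸ m)) × m + (l ∸ m) ≤ n

      new-i : new (length i)
      new-i = all′ , max′
        where
        all′ : ∀ {j} → j < suc i → length j ≤ m + (length i ∸ m)
        all′ {j} j< with j ≟ i
        ... | yes refl = m≤n+m∸n (length i) m
        ... | no j≢i   = ≤-trans (all (≤∧≢⇒< (≤-pred j<) j≢i)) (m≤m+n m _)

        max′ : m + (length i ∸ m) ≤ n
        max′ with ≤-total m (length i)
        ... | inj₁ le = subst (_≤ n) (sym (m+[n∸m]≡n le)) (upper i<k)
        ... | inj₂ ge = subst (_≤ n) (sym (trans (cong (m +_) (m≤n⇒m∸n≡0 ge)) (+-identityʳ m))) max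

  term : (ℕ → ℚ) → ℕ → ℕ → ℚ
  term f m i = weight i ℚ.* Table.dp f (sample i) m (length i ∸ 1)

  score : (ℕ → ℚ) → ℕ → ℚ
  score f m = Σ< (term f m) k

  module _ (length≥1 : ∀ {i} → i < k → 1 ≤ length i) {N} (length≤N : ∀ {i} → i < k → length i ≤ N) where

    accumulate-run : ∀ {f m i a σ} → Given σ → nat σ vLast 0 0 ≡ m → nat σ vSeries 0 0 ≡ i → i < k →
                     (∀ {j} → j ≤ m → rat σ vSeq 0 j ≡ f j) → suc m ≤ N →
                     rat σ vTotal 0 0 ≡ a →
                     Run accumulate σ (λ σ′ → rat σ′ vTotal 0 0 ≡ a ℚ.+ term f m i) (accumulateTime N)
    accumulate-run {f} {m} {i} {a} {σ} h m≡ i≡ i<k f≡ m<N a≡ = ⨾-run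
      (fillTable-run m≡ length≡ f≡
        (λ q → trans (cong (λ i → rat σ vSample i q) i≡) (samples h i q)) m<N (length≤N i<k))
      λ {σ′} fr rows → assignℚ-run (cong₂ ℚ._+_
        (trans (ratKept fr vTotal refl 0 0) a≡)
        (cong₂ ℚ._*_
          (trans (ratKept fr vWeight refl 0 _)
            (trans (cong (rat σ vWeight 0) (trans (natKept fr vSeries refl 0 0) i≡)) (weights h i)))
          (trans (cong₂ (rat σ′ vTable) (trans (natKept fr vLast refl 0 0) m≡)
                   (cong (_∸ 1) (trans (natKept fr vLength refl _ 0)
                     (trans (cong (λ i → nat σ vLength i 0) (natKept fr vSeries refl 0 0)) length≡))))
                 (rows (n<1+n m) (∸-monoʳ-< (s≤s z≤n) (length≥1 i<k))))))
      where
      open Cell f (sample i)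
      length≡ : evalℕ sampleLength σ ≡ length i
      length≡ = trans (cong (λ i → nat σ vLength i 0) i≡) (lengths h i)

    evaluate-run : 1 ≤ k → ∀ {f m σ} → Given σ → nat σ vLast 0 0 ≡ m →
                   (∀ {j} → j ≤ m → rat σ vSeq 0 j ≡ f j) → suc m ≤ N →
                   Run evaluate σ (λ σ′ → rat σ′ vTotal 0 0 ≡ score f m) (evaluateTime k N)
    evaluate-run 1≤k {f} {m} {σ} h m≡ f≡ m<N = assignℚ-⨾-run
      (for-run {c = vSeries} (λ i σ → rat σ vTotal 0 0 ≡ Σ< (term f m) i) z≤n refl
        (λ fr → trans (natKept fr vSize refl 0 0) (size h))
        refl
        (λ i<k fr i≡ a≡ → accumulate-run
          (given-kept refl refl refl refl fr
            (given-kept refl refl refl refl (frame (⇓assignℚ {vTotal} {lit 0} {lit 0} {lit 0ℚ})) h))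
          (trans (natKept fr vLast refl 0 0) m≡) i≡ i<k
          (λ j≤m → trans (ratKept fr vSeq refl 0 _) (f≡ j≤m)) m<N a≡)
        ≤-refl 1≤k (≤-trans (s≤s z≤n) (m≤n+m 3 _)))

-- Arrays holding alternating series

bit-not : ∀ b → 1ℚ ℚ.- bit b ≡ bit (not b)
bit-not false = refl
bit-not true  = refl

Alternates : Name → Bool → ℕ → State → Set
Alternates a b m σ = ∀ {j} → j ≤ m → rat σ a 0 j ≡ bit (alternate b j)

alternates-extend : ∀ {a b m v σ} → Alternates a b m σ → v ≡ 1ℚ ℚ.- rat σ a 0 m →
                    Alternates a b (suc m) ⟨ nat σ , rat σ [ a , 0 , suc m ]≔ v ⟩
alternates-extend {a} {b} {m} {v} {σ} alt v≡ {j} j≤ with j ≟ suc m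
... | yes refl = trans (update-hit (rat σ) a 0 (suc m) v)
                   (trans v≡ (trans (cong (λ q → 1ℚ ℚ.- q) (alt ≤-refl)) (bit-not (alternate b m))))
... | no  j≢   = trans (update-miss (rat σ) a 0 (suc m) v (j≢ ∘ proj₂ ∘ proj₂))
                   (alt (≤-pred (≤∧≢⇒< j≤ j≢)))

alternates-extend-run : ∀ {a c b m σ} → nat σ c 0 0 ≡ m → Alternates a b m σ →
  Run (assignℚ a (lit 0) (plus1 (var c)) (op sub (lit 1ℚ) (read a (lit 0) (var c)))) σ
      (Alternates a b (suc m)) 2
alternates-extend-run {a} {c} {b} {m} {σ} c≡m alt = assignℚ-run
  (λ {j} j≤ → trans (cong (λ i → (rat σ [ a , 0 , i ]≔ v) a 0 j) (trans (cong (_+ 1) c≡m) (+-comm m 1)))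
    (alternates-extend {σ = σ} alt (cong (λ i → 1ℚ ℚ.- rat σ a 0 i) c≡m) j≤))
  where
  v : ℚ
  v = 1ℚ ℚ.- rat σ a 0 (nat σ c 0 0)

writeMean-run : ∀ {b m N σ} → m < N → nat σ vOut 0 0 ≡ suc m → rat σ vMean 0 0 ≡ bit b →
                Run writeMean σ (Alternates vMean b (suc m)) (meanTime N)
writeMean-run {b} m<N out≡ head = for-run {c = vPosition} (Alternates vMean b) z≤n refl
  (λ fr → trans (natKept fr vOut refl 0 0) out≡)
  (λ { z≤n → head })
  (λ _ _ r≡ alt → alternates-extend-run {vMean} {vPosition} r≡ alt)
  m<N (≤-trans (s≤s z≤n) m<N) (s≤s z≤n)

candidateTime candidatesTime : ℕ → ℕ → ℕ
candidateTime  k N = evaluateTime k N + 4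
candidatesTime k N = 8 * (N * candidateTime k N)

-- Search among the candidates

module Search (k : ℕ) (length : ℕ → ℕ) (weight : ℕ → ℚ) (sample : ℕ → ℕ → ℚ)
              (1≤k : 1 ≤ k) (length≥1 : ∀ {i} → i < k → 1 ≤ length i)
              {N : ℕ} (1≤N : 1 ≤ N) (length≤N : ∀ {i} → i < k → length i ≤ N) where

  open Problem k length weight sample

  value : Bool → ℕ → ℚ
  value b = score (bit ∘ alternate b)

  -- The best candidate so far, present in memory only through its first entry, length and score.
  -- `Tried` is a parameter that each phase of the search enlarges; `last<N` will bound the time for
  -- writing the mean.
  record Champion (Tried : Bool → ℕ → Set) (σ : State) : Set where
    field
      {start} : Bool
      {last}  : ℕ
      last<N  : last < N
      stored  : nat σ vOut 0 0 ≡ suc last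
      head    : rat σ vMean 0 0 ≡ bit start
      best    : rat σ vBest 0 0 ≡ value start last
      least   : ∀ {b m} → Tried b m → value start last ℚ.≤ value b m

  champion-cong : ∀ {Tried σ σ′} → nat σ′ vOut 0 0 ≡ nat σ vOut 0 0 →
                  rat σ′ vMean 0 0 ≡ rat σ vMean 0 0 → rat σ′ vBest 0 0 ≡ rat σ vBest 0 0 →
                  Champion Tried σ → Champion Tried σ′
  champion-cong out≡ mean≡ best≡ ch = record
    { last<N = last<N
    ; stored = trans out≡ stored
    ; head   = trans mean≡ head
    ; best   = trans best≡ best
    ; least  = least
    }
    where open Champion ch

  keep-run : ∀ {Tried b m σ} → m < N → nat σ vLast 0 0 ≡ m → Alternates vSeq b m σ →
             rat σ vTotal 0 0 ≡ value b m →
             (∀ {b′ m′} → Tried b′ m′ → value b m ℚ.≤ value b′ m′) →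
             Run keep σ (Champion Tried) 1
  keep-run {m = m} m<N m≡ alt total≡ least = assignℚ-⨾-run (assignℕ-⨾-run (assignℚ-run record
    { last<N = m<N
    ; stored = trans (cong (_+ 1) m≡) (+-comm m 1)
    ; head   = alt z≤n
    ; best   = total≡
    ; least  = least
    }))

  -- Supplies a genuine initial value for the running minimum, since no rational acts as infinity.
  -- Nothing counts as tried yet: the first loop evaluates the series (0) again.
  firstCandidate-run : ∀ {σ} → Given σ → Run firstCandidate σ (Champion (λ _ _ → ⊥)) (evaluateTime k N + 1)
  firstCandidate-run {σ} h = assignℚ-⨾-run (assignℕ-⨾-run (⨾-run
    (evaluate-run length≥1 length≤N 1≤k
      (given-kept refl refl refl refl (frame (⇓assignℕ {vLast} {lit 0} {lit 0} {lit 0}))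
        (given-kept refl refl refl refl (frame (⇓assignℚ {vSeq} {lit 0} {lit 0} {lit 0ℚ})) h))
      refl alt 1≤N)
    λ fr total≡ → keep-run 1≤N (natKept fr vLast refl 0 0)
      (λ j≤0 → trans (ratKept fr vSeq refl 0 _) (alt j≤0)) total≡ λ ()))
    where
    alt : Alternates vSeq false 0 ⟨ nat σ [ vLast , 0 , 0 ]≔ 0 , rat σ [ vSeq , 0 , 0 ]≔ 0ℚ ⟩
    alt z≤n = refl

  module _ {Tried : Bool → ℕ → Set} (b : Bool) where

    TriedAlso : ℕ → Bool → ℕ → Set
    TriedAlso m b′ m′ = Tried b′ m′ ⊎ (b′ ≡ b × m′ < m)

    Invariant : ℕ → State → Set
    Invariant m σ = Alternates vSeq b m σ × Champion (TriedAlso m) σ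

    private
      select : Program
      select = branch (varℚ vTotal ≤ℚ varℚ vBest) keep skip

      tried-suc : ∀ {m b′ m′} → TriedAlso (suc m) b′ m′ → TriedAlso m b′ m′ ⊎ (b′ ≡ b × m′ ≡ m)
      tried-suc (inj₁ t) = inj₁ (inj₁ t)
      tried-suc {m} {m′ = m′} (inj₂ (e , m′<)) with m′ ≟ m
      ... | yes m′≡m = inj₂ (e , m′≡m)
      ... | no  m′≢m = inj₁ (inj₂ (e , ≤∧≢⇒< (≤-pred m′<) m′≢m))

    select-run : ∀ {m σ} → m < N → nat σ vLast 0 0 ≡ m → Alternates vSeq b m σ →
                 rat σ vTotal 0 0 ≡ value b m → Champion (TriedAlso m) σ →
                 Run select σ (Champion (TriedAlso (suc m))) 2
    select-run {m} {σ} m<N m≡ alt total≡ ch = branchℚ-run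
      (λ le → keep-run m<N m≡ alt total≡
        λ t → [ (λ t → ℚₚ.≤-trans (subst₂ ℚ._≤_ total≡ best le) (least t))
              , (λ { (refl , refl) → ℚₚ.≤-refl }) ] (tried-suc t))
      (λ ≰ → weaken (λ _ c → c) z≤n (skip-run record
        { last<N = last<N ; stored = stored ; head = head ; best = best
        ; least  = λ t → [ least
                         , (λ { (refl , refl) → ℚₚ.<⇒≤ (subst₂ ℚ._<_ best total≡ (ℚₚ.≰⇒> ≰)) }) ]
                         (tried-suc t) }))
      where open Champion ch

    candidates-run : ∀ {σ} → Given σ → nat σ vBound 0 0 ≡ N → Champion Tried σ →
                     Run (vSeq ≔ℚ lit (bit b) ⨾ candidates) σ (Champion (TriedAlso N)) (candidatesTime k N)
    candidates-run {σ} h N≡ ch = assignℚ-⨾-run (weaken (λ _ → proj₂) ≤-refl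
      (for-run {c = vLast} Invariant z≤n refl
        (λ fr → trans (natKept fr vBound refl 0 0) N≡)
        ((λ { z≤n → refl }) , initial)
        step ≤-refl 1≤N (≤-trans (s≤s z≤n) (m≤n+m 4 _))))
      where
      open Champion ch
      σ₀ : State
      σ₀ = ⟨ nat σ , rat σ [ vSeq , 0 , 0 ]≔ bit b ⟩

      initial : Champion (TriedAlso 0) (setℕ vLast 0 σ₀)
      initial = record { last<N = last<N ; stored = stored ; head = head ; best = best
                       ; least = λ { (inj₁ t) → least t } }

      h₀ : Given σ₀
      h₀ = given-kept refl refl refl refl (frame (⇓assignℚ {vSeq} {lit 0} {lit 0} {lit (bit b)})) h

      step : ∀ {m σ′} → m < N → Frame candidates σ₀ σ′ → nat σ′ vLast 0 0 ≡ m → Invariant m σ′ →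
             Run (evaluate ⨾ select ⨾ extendSeq) σ′
                 (λ σ″ → Invariant (suc m) (setℕ vLast (nat σ″ vLast 0 0 + 1) σ″)) (candidateTime k N)
      step {m} {σ′} m<N fr m≡ (alt , ch) = ⨾-run
        (evaluate-run length≥1 length≤N 1≤k (given-kept refl refl refl refl fr h₀) m≡ alt m<N)
        λ {σ″} fr₁ total≡ →
        ⨾-run (select-run m<N (trans (natKept fr₁ vLast refl 0 0) m≡)
                (λ j≤m → trans (ratKept fr₁ vSeq refl 0 _) (alt j≤m)) total≡
                (champion-cong (natKept fr₁ vOut refl 0 0) (ratKept fr₁ vMean refl 0 0)
                  (ratKept fr₁ vBest refl 0 0) ch))
        λ {σ‴} fr₂ ch′ →
        weaken {P = Alternates vSeq b (suc m)}
          (λ fr₃ alt′ → alt′ , champion-cong (natKept fr₃ vOut refl 0 0)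
            (ratKept fr₃ vMean refl 0 0) (ratKept fr₃ vBest refl 0 0) ch′) ≤-refl
          (alternates-extend-run {vSeq} {vLast}
            (trans (natKept fr₂ vLast refl 0 0) (trans (natKept fr₁ vLast refl 0 0) m≡))
            (λ j≤m → trans (ratKept fr₂ vSeq refl 0 _) (trans (ratKept fr₁ vSeq refl 0 _) (alt j≤m))))

-- Growth of running times

-- The O-notation for positive arguments, with its constant as data. Closure under sums and products
-- follows the shape of the program and assembles the constant automatically.
record Growth (a b : ℕ) (T : ℕ → ℕ → ℕ) : Set where
  constructor growth
  field
    factor : ℕ
    bound  : ∀ {k N} → 1 ≤ k → 1 ≤ N → T k N ≤ factor * (k ^ a * N ^ b)

1≤^ : ∀ {m} a → 1 ≤ m → 1 ≤ m ^ a
1≤^ {suc m} a _ = m^n>0 (suc m) a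

*-swap : ∀ a b c → a * (b * c) ≡ b * (a * c)
*-swap a b c = trans (sym (*-assoc a b c)) (trans (cong (_* c) (*-comm a b)) (*-assoc b a c))

growth-const : ∀ c {a b} → Growth a b (λ _ _ → c)
growth-const c {a} {b} = growth c λ {k} {N} 1≤k 1≤N →
  subst (_≤ c * (k ^ a * N ^ b)) (*-identityʳ c) (*-monoʳ-≤ c (*-mono-≤ (1≤^ a 1≤k) (1≤^ b 1≤N)))

growth-+ : ∀ {a b S T} → Growth a b S → Growth a b T → Growth a b (λ k N → S k N + T k N)
growth-+ {a} {b} (growth C s) (growth D t) = growth (C + D) λ {k} {N} 1≤k 1≤N →
  ≤-trans (+-mono-≤ (s 1≤k 1≤N) (t 1≤k 1≤N)) (≤-reflexive (sym (*-distribʳ-+ (k ^ a * N ^ b) C D)))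

growth-scale : ∀ c {a b T} → Growth a b T → Growth a b (λ k N → c * T k N)
growth-scale c {a} {b} (growth C t) = growth (c * C) λ {k} {N} 1≤k 1≤N →
  ≤-trans (*-monoʳ-≤ c (t 1≤k 1≤N)) (≤-reflexive (sym (*-assoc c C (k ^ a * N ^ b))))

growth-k* : ∀ {a b T} → Growth a b T → Growth (suc a) b (λ k N → k * T k N)
growth-k* {a} {b} (growth C t) = growth C λ {k} {N} 1≤k 1≤N →
  ≤-trans (*-monoʳ-≤ k (t 1≤k 1≤N)) (≤-reflexive (trans (*-swap k C (k ^ a * N ^ b))
    (cong (C *_) (sym (*-assoc k (k ^ a) (N ^ b))))))

growth-N* : ∀ {a b T} → Growth a b T → Growth a (suc b) (λ k N → N * T k N)
growth-N* {a} {b} (growth C t) = growth C λ {k} {N} 1≤k 1≤N →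
  ≤-trans (*-monoʳ-≤ N (t 1≤k 1≤N)) (≤-reflexive (trans (*-swap N C (k ^ a * N ^ b))
    (cong (C *_) (*-swap N (k ^ a) (N ^ b)))))

growth-widen : ∀ {a b a′ b′ T} → a ≤ a′ → b ≤ b′ → Growth a b T → Growth a′ b′ T
growth-widen {a} {b} {a′} {b′} a≤ b≤ (growth C t) = growth C λ {k} {N} 1≤k 1≤N →
  ≤-trans (t 1≤k 1≤N) (*-monoʳ-≤ C (*-mono-≤ (^-mono a≤ 1≤k) (^-mono b≤ 1≤N)))
  where
  ^-mono : ∀ {m a b} → a ≤ b → 1 ≤ m → m ^ a ≤ m ^ b
  ^-mono {suc m} a≤b _ = ^-monoʳ-≤ (suc m) a≤b

totalTime : ℕ → ℕ → ℕ
totalTime k N = measureTime k + (evaluateTime k N + 1 +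
  (candidatesTime k N + (candidatesTime k N + meanTime N)))

accumulateTime-growth : Growth 0 2 (λ _ → accumulateTime)
accumulateTime-growth = growth-+
  (growth-scale 8 (growth-N* (growth-scale 8 (growth-N* (growth-const 14))))) (growth-const 3)

evaluateTime-growth : Growth 1 2 evaluateTime
evaluateTime-growth = growth-scale 8 (growth-k* accumulateTime-growth)

candidatesTime-growth : Growth 1 3 candidatesTime
candidatesTime-growth = growth-scale 8 (growth-N* (growth-+ evaluateTime-growth (growth-const 4)))

measureTime-growth : Growth 1 0 (λ k _ → measureTime k)
measureTime-growth = growth-+ (growth-scale 8 (growth-k* (growth-const 2))) (growth-const 2)

meanTime-growth : Growth 0 1 (λ _ → meanTime)
meanTime-growth = growth-scale 8 (growth-N* (growth-const 2))

abstract
  -- Abstract, so that the constant stays opaque in the final bound and is not unfolded into a large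
  -- numeral.
  totalTime-growth : Growth 1 3 totalTime
  totalTime-growth =
    growth-+ (growth-widen ≤-refl z≤n measureTime-growth)
    (growth-+ (growth-+ (growth-widen ≤-refl (n≤1+n 2) evaluateTime-growth) (growth-const 1))
    (growth-+ candidatesTime-growth
    (growth-+ candidatesTime-growth
              (growth-widen z≤n (s≤s z≤n) meanTime-growth))))

-- Maxima and sums over the sample

foldr-⊔-upper : ∀ {k} (f : Fin k → ℕ) i → f i ≤ Vector.foldr _⊔_ 0 f
foldr-⊔-upper f Fin.zero    = m≤m⊔n (f Fin.zero) _
foldr-⊔-upper f (Fin.suc i) = ≤-trans (foldr-⊔-upper (f ∘ Fin.suc) i) (m≤n⊔m (f Fin.zero) _)

foldr-⊔-lub : ∀ {k} (f : Fin k → ℕ) {n} → (∀ i → f i ≤ n) → Vector.foldr _⊔_ 0 f ≤ n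
foldr-⊔-lub {zero}  f h = z≤n
foldr-⊔-lub {suc k} f h = ⊔-lub (h Fin.zero) (foldr-⊔-lub (f ∘ Fin.suc) (h ∘ Fin.suc))

sum-mono : ∀ {k} {f g : Fin k → ℚ} → (∀ i → f i ℚ.≤ g i) → sum f ℚ.≤ sum g
sum-mono {zero}  h = ℚₚ.≤-refl
sum-mono {suc k} h = ℚₚ.+-mono-≤ (h Fin.zero) (sum-mono (h ∘ Fin.suc))

-- The sum in `F` has its first term outermost, whereas the loop of `evaluate` adds the last term
-- last; hence the induction splits off the last term.
sum≡Σ< : ∀ (f : ℕ → ℚ) k → sum {k} (f ∘ toℕ) ≡ Σ< f k
sum≡Σ< f zero    = refl
sum≡Σ< f (suc k) = trans (sum-init-last {k} (f ∘ toℕ)) (cong₂ ℚ._+_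
  (trans (sum-cong-≗ {k} (cong f ∘ Finₚ.toℕ-inject₁)) (sum≡Σ< f k))
  (cong f (Finₚ.toℕ-fromℕ k)))

module _ {k : ℕ} (S : Sample k) where

  -- This is where nonnegativity of the weights enters.
  F-mono : ∀ z z′ → (∀ i → dtw² ⟦ z ⟧ ⟦ series S i ⟧ ℚ.≤ dtw² ⟦ z′ ⟧ ⟦ series S i ⟧) →
           F S z ℚ.≤ F S z′
  F-mono z z′ h = sum-mono {k} λ i →
    ℚₚ.*-monoˡ-≤-nonNeg (weight S i) {{ℚ.nonNegative (weight-≥0 S i)}} (h i)

-- From the search to a binary mean

module Correctness {k : ℕ} (1≤k : 1 ≤ k) (S : Sample k) (σ : State) (input : Input S σ) where
  open Input input

  length : ℕ → ℕ
  length i = nat σ vLength i 0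

  n N : ℕ
  n = maxLength S
  N = n + (n + n)

  length≡ : ∀ {i} (i<k : i < k) → length i ≡ List⁺.length (series S (fromℕ< i<k))
  length≡ i<k = trans (cong length (sym (Finₚ.toℕ-fromℕ< i<k)))
                      (Stores.length (samples (fromℕ< i<k)))

  length≥1 : ∀ {i} → i < k → 1 ≤ length i
  length≥1 i<k = ≤-trans (s≤s z≤n) (≤-reflexive (sym (length≡ i<k)))

  length≤n : ∀ {i} → i < k → length i ≤ n
  length≤n i<k = ≤-trans (≤-reflexive (length≡ i<k))
    (foldr-⊔-upper (λ i → List⁺.length (series S i)) (fromℕ< i<k))

  n-lub : ∀ {l} → (∀ {i} → i < k → length i ≤ l) → n ≤ l
  n-lub {l} h = foldr-⊔-lub (λ i → List⁺.length (series S i)) λ i →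
    ≤-trans (≤-reflexive (sym (Stores.length (samples i)))) (h {toℕ i} (Finₚ.toℕ<n i))

  1≤n : 1 ≤ n
  1≤n = ≤-trans (length≥1 {0} 1≤k) (length≤n {0} 1≤k)

  1≤N : 1 ≤ N
  1≤N = ≤-trans 1≤n (m≤m+n n (n + n))

  open Search k length (rat σ vWeight 0) (rat σ vSample) 1≤k length≥1
              1≤N (λ i<k → ≤-trans (length≤n i<k) (m≤m+n n (n + n)))
  open Problem k length (rat σ vWeight 0) (rat σ vSample)

  F≡value : ∀ b m → F S (alternating b m) ≡ value b m
  F≡value b m = trans (sum-cong-≗ {k} λ i → cong₂ ℚ._*_ (sym (weights i))
      (trans (dtw²-alternating b m ⟦ series S i ⟧ (rat σ vSample (toℕ i)) (Stores.entries (samples i)))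
        (cong (Table.dp (bit ∘ alternate b) (rat σ vSample (toℕ i)) m)
          (trans (lastIndex-⟦⟧ (series S i)) (cong (_∸ 1) (sym (Stores.length (samples i))))))))
    (sum≡Σ< (term (bit ∘ alternate b) m) k)

  given : Given σ
  given = record { size = size ; lengths = λ _ → refl ; weights = λ _ → refl ; samples = λ _ _ → refl }

  optimal : ∀ {b m} → (∀ {b′ m′} → m′ < N → value b m ℚ.≤ value b′ m′) →
            IsBinaryMean S (alternating b m)
  optimal {b} {m} least z = let b′ , m′ , dominates = condense z in
    ℚₚ.≤-trans (below b′ m′) (F-mono S (alternating b′ m′) z (dominates ∘ series S))
    where
    below : ∀ b′ m′ → F S (alternating b m) ℚ.≤ F S (alternating b′ m′)
    below b′ m′ with m′ <? N
    ... | yes m′<N = subst₂ ℚ._≤_ (sym (F≡value b m)) (sym (F≡value b′ m′)) (least m′<N)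
    -- Outside the range of the search, the comparison passes through the series (0), which lies in
    -- the range because `1 ≤ N`.
    ... | no  m′≮N = ℚₚ.≤-trans
      (subst₂ ℚ._≤_ (sym (F≡value b m)) (sym (F≡value false 0)) (least 1≤N))
      (F-mono S (alternating false 0) (alternating b′ m′) λ i →
        long-alternating b′ (series S i) (≤-trans (3*≤N i) (≮⇒≥ m′≮N)))
      where
      3*≤N : ∀ i → 3 * List⁺.length (series S i) ≤ N
      3*≤N i = +-mono-≤ l≤n (+-mono-≤ l≤n (subst (_≤ n) (sym (+-identityʳ _)) l≤n))
        where
        l≤n : List⁺.length (series S i) ≤ n
        l≤n = foldr-⊔-upper (λ i → List⁺.length (series S i)) i

  Result : State → Set
  Result σ′ = ∃[ z ] (Output z σ′ × IsBinaryMean S z)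

  -- The form that two uses of `candidates-run`, for first entry 0 and then 1, build from the empty
  -- predicate.
  Tried : Bool → ℕ → Set
  Tried b m = ((⊥ ⊎ (b ≡ false × m < N)) ⊎ (b ≡ true × m < N))

  output : ∀ {σ′} → Champion Tried σ′ → Run writeMean σ′ Result (meanTime N)
  output {σ′} ch = weaken {P = Alternates vMean start (suc last)} stores ≤-refl
    (writeMean-run last<N stored head)
    where
    open Champion ch

    stores : ∀ {σ″} → Frame writeMean σ′ σ″ → Alternates vMean start (suc last) σ″ → Result σ″
    stores {σ″} fr alt = alternating start last , record
      { length  = trans (natKept fr vOut refl 0 0)
                    (trans stored (cong suc (sym (Listₚ.length-applyUpTo (alternate start ∘ suc) last))))
      ; entries = λ j → trans
          (alt (≤-trans (Finₚ.toℕ≤pred[n] j) (≤-trans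
            (≤-reflexive (lastIndex-prefix (alternate start) last)) (n≤1+n last))))
          (prefix-! (alternate start) last j)
      } , optimal λ { {false} m< → least (inj₁ (inj₂ (refl , m<)))
                    ; {true}  m< → least (inj₂ (refl , m<)) }

  binaryMean-run : Run binaryMean σ Result (totalTime k N)
  binaryMean-run =
    ⨾-run (measure-run 1≤k given length≤n n-lub) λ {σ₁} fr₁ bound≡₁ →
    let given₁ = given-kept refl refl refl refl fr₁ given in
    ⨾-run (firstCandidate-run given₁) λ {σ₂} fr₂ ch₂ →
    let given₂ = given-kept refl refl refl refl fr₂ given₁
        bound≡₂ = trans (natKept fr₂ vBound refl 0 0) bound≡₁ in
    ⨾-run (candidates-run false given₂ bound≡₂ ch₂) λ {σ₃} fr₃ ch₃ →
    let given₃ = given-kept refl refl refl refl fr₃ given₂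
        bound≡₃ = trans (natKept fr₃ vBound refl 0 0) bound≡₂ in
    ⨾-run (candidates-run true given₃ bound≡₃ ch₃) λ {σ₄} fr₄ ch₄ → output ch₄

theorem1 : Σ[ π ∈ Program ] Σ[ C ∈ ℕ ]
    (∀ (k : ℕ) .{{_ : NonZero k}} (S : Sample k) (σ : State) → Input S σ →
    ∃[ σ′ ] ∃[ t ] ∃[ z ]
    ((π , σ ⇓ σ′ # t) × Output z σ′ × IsBinaryMean S z ×
    t ≤ C * (k * maxLength S ^ 3)))
-- The time bound is cubic in `N`, which is three times the maximal length; hence the `3 ^ 3`.
theorem1 = binaryMean , factor * 3 ^ 3 , correct
  where
  open Growth totalTime-growth

  correct : ∀ (k : ℕ) .{{_ : NonZero k}} (S : Sample k) (σ : State) → Input S σ →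
    ∃[ σ′ ] ∃[ t ] ∃[ z ]
    ((binaryMean , σ ⇓ σ′ # t) × Output z σ′ × IsBinaryMean S z ×
    t ≤ factor * 3 ^ 3 * (k * maxLength S ^ 3))
  correct k S σ input = conclude binaryMean-run
    where
    open Correctness {k} (>-nonZero⁻¹ k) S σ input

    tripled : ∀ n → (n + (n + n)) ^ 3 ≡ 3 ^ 3 * n ^ 3
    tripled = solve 1 (λ n → (n :+ (n :+ n)) :^ 3 := con 27 :* n :^ 3) refl
      where open ℕSolver.+-*-Solver

    cube : factor * (k ^ 1 * N ^ 3) ≡ factor * 3 ^ 3 * (k * n ^ 3)
    cube = begin
      factor * (k ^ 1 * N ^ 3)       ≡⟨ cong₂ (λ a b → factor * (a * b)) (*-identityʳ k) (tripled n) ⟩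
      factor * (k * (3 ^ 3 * n ^ 3)) ≡⟨ cong (factor *_) (*-swap k (3 ^ 3) (n ^ 3)) ⟩
      factor * (3 ^ 3 * (k * n ^ 3)) ≡⟨ *-assoc factor (3 ^ 3) (k * n ^ 3) ⟨
      factor * 3 ^ 3 * (k * n ^ 3)   ∎
      where open ≡-Reasoning

    conclude : Run binaryMean σ Result (totalTime k N) →
      ∃[ σ′ ] ∃[ t ] ∃[ z ]
      ((binaryMean , σ ⇓ σ′ # t) × Output z σ′ × IsBinaryMean S z ×
      t ≤ factor * 3 ^ 3 * (k * maxLength S ^ 3))
    conclude (run halts (z , out , mean) t≤) = _ , _ , z , halts , out , mean ,
      ≤-trans t≤ (≤-trans (bound (>-nonZero⁻¹ k) 1≤N) (≤-reflexive cube))
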